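{- $\mathcal{TC}(\mathrm{UF})=\mathrm{CS}$.
   Context: $\mathrm{CS}$ denotes the family of context-sensitive languages. $\mathrm{UF}$ is the family of union-free languages: languages described by a regular expression built from $\emptyset$ and single letters using only concatenation and Kleene star (no union). A tree-controlled grammar is a quintuple $G=(N,T,P,S,R)$ where $(N,T,P,S)$ is a context-free grammar whose rules are all non-erasing (the only exception being that $S\to\lambda$ is allowed if $S$ does not occur on the right-hand side of any rule), and $R$ is a regular language over $N\cup T$. For a derivation tree, the word of level $j$ is the word formed by all nodes of depth $j$ read from left to right. $L(G)$ consists of all $z\in T^*$ having a derivation tree $t$ whose leaves read left to right give $z$ and such that the words of all levels of $t$, except the last one, belong to $R$. For a family $\mathcal{F}$ of regular languages, $\mathcal{TC}(\mathcal{F})$ is the family of languages $L(G)$ of tree-controlled grammars with $R\in\mathcal{F}$. -}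

module Defs where

open import Data.Nat using (ℕ; zero; suc; _<_; _⊔_)
open import Data.Fin using (Fin)
open import Data.List using (List; []; _∷_; [_]; _++_; map)
open import Data.List.Membership.Propositional using (_∈_; _∉_)
open import Data.Sum using (_⊎_; inj₁; inj₂)
open import Data.Product using (Σ; _×_; _,_; ∃; ∃-syntax)
open import Data.Empty using (⊥)
open import Data.Unit using (⊤)
open import Relation.Binary.PropositionalEquality using (_≡_; _≢_)
open import Relation.Binary.Construct.Closure.ReflexiveTransitive using (Star)

Language : ℕ → Set₁
Language k = List (Fin k) → Set

_≐_ : ∀ {k} → Language k → Language k → Set
L ≐ L' = (∀ w → L w → L' w) × (∀ w → L' w → L w)

-- symbols of a grammar with nonterminals Fin m and terminals Fin k
Sym : ℕ → ℕ → Set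
Sym m k = Fin m ⊎ Fin k

data UFExp (A : Set) : Set where
  ∅    : UFExp A
  lit  : A → UFExp A
  _·_  : UFExp A → UFExp A → UFExp A
  _*   : UFExp A → UFExp A

data ⟦_⟧ {A : Set} : UFExp A → List A → Set where
  lit  : ∀ {a} → ⟦ lit a ⟧ [ a ]
  cat  : ∀ {e f u v} → ⟦ e ⟧ u → ⟦ f ⟧ v → ⟦ e · f ⟧ (u ++ v)
  nil  : ∀ {e} → ⟦ e * ⟧ []
  more : ∀ {e u v} → ⟦ e ⟧ u → ⟦ e * ⟧ v → ⟦ e * ⟧ (u ++ v)

module _ {m k : ℕ} where

  data Tree : Set where
    leaf  : Fin k → Tree
    node  : Fin m → List Tree → Tree
    nodeλ : Fin m → Tree                 -- nonterminal node whose only child is a λ-leaf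

  label : Tree → Sym m k
  label (leaf a)  = inj₂ a
  label (node A _) = inj₁ A
  label (nodeλ A) = inj₁ A

  mutual
    -- word of level j (nodes of depth j, left to right; λ-leaves contribute λ)
    level : ℕ → Tree → List (Sym m k)
    level zero    t          = [ label t ]
    level (suc j) (leaf a)   = []
    level (suc j) (node A ts) = levels j ts
    level (suc j) (nodeλ A)  = []

    levels : ℕ → List Tree → List (Sym m k)
    levels j []       = []
    levels j (t ∷ ts) = level j t ++ levels j ts

  mutual
    -- depth of the deepest node (index of the last level)
    height : Tree → ℕ
    height (leaf a)   = 0
    height (node A ts) = suc (heights ts)
    height (nodeλ A)  = 1

    heights : List Tree → ℕ
    heights []       = 0
    heights (t ∷ ts) = height t ⊔ heights ts

  mutual
    yield : Tree → List (Fin k)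
    yield (leaf a)   = [ a ]
    yield (node A ts) = yields ts
    yield (nodeλ A)  = []

    yields : List Tree → List (Fin k)
    yields []       = []
    yields (t ∷ ts) = yield t ++ yields ts

  mutual
    Valid : List (Fin m × List (Sym m k)) → Tree → Set
    Valid P (leaf a)   = ⊤
    Valid P (node A ts) = (ts ≢ []) × ((A , map label ts) ∈ P) × AllValid P ts
    Valid P (nodeλ A)  = (A , []) ∈ P

    AllValid : List (Fin m × List (Sym m k)) → List Tree → Set
    AllValid P []       = ⊤
    AllValid P (t ∷ ts) = Valid P t × AllValid P ts

record TCG (k : ℕ) : Set where
  field
    m  : ℕ
    S  : Fin m
    P  : List (Fin m × List (Sym m k))
    wf : ∀ {A α} → (A , α) ∈ P →
           (α ≢ []) ⊎ ((A ≡ S) × (α ≡ []) × (∀ {B β} → (B , β) ∈ P → inj₁ S ∉ β))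
    R  : UFExp (Sym m k)

  lang : Language k
  lang z = Σ (Tree {m} {k}) λ t →
             (label t ≡ inj₁ S) × Valid P t × (yield t ≡ z) ×
             (∀ j → j < height t → ⟦ R ⟧ (level j t))

InTCUF : ∀ {k} → Language k → Set
InTCUF {k} L = Σ (TCG k) λ G → L ≐ TCG.lang G

record CSRule (m k : ℕ) : Set where
  constructor csrule
  field
    left  : List (Sym m k)
    A     : Fin m
    right : List (Sym m k)
    γ     : List (Sym m k)

  lhs : List (Sym m k)
  lhs = left ++ inj₁ A ∷ right

  rhs : List (Sym m k)
  rhs = left ++ γ ++ right

record CSG (k : ℕ) : Set where
  field
    m  : ℕ
    S  : Fin m
    P  : List (CSRule m k)
    wf : ∀ {r} → r ∈ P →
           (CSRule.γ r ≢ []) ⊎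
           ((CSRule.left r ≡ []) × (CSRule.A r ≡ S) × (CSRule.right r ≡ []) ×
            (CSRule.γ r ≡ []) × (∀ {r'} → r' ∈ P → inj₁ S ∉ CSRule.rhs r'))

  data _⇒_ : List (Sym m k) → List (Sym m k) → Set where
    step : ∀ {r} p q → r ∈ P → (p ++ CSRule.lhs r ++ q) ⇒ (p ++ CSRule.rhs r ++ q)

  lang : Language k
  lang w = Star _⇒_ [ inj₁ S ] (map inj₂ w)

InCS : ∀ {k} → Language k → Set
InCS {k} L = Σ (CSG k) λ G → L ≐ CSG.lang G

{-# OPTIONS --safe #-}

-- A star absorbs unions, (b₁ ∪ … ∪ bₙ)* = (b₁* ⋯ bₙ*)*, so a union-free control can demand that every level be
-- a concatenation of blocks from a finite list. For a context-sensitive grammar, take as blocks all single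
-- symbols and all words u Aᵣ v, where r : u A v → u γ v is a rule and Aᵣ a new nonterminal obtained from A
-- and expanding to γ; all other symbols may be copied. A level then rewrites A only next to u and v.
--
-- Conversely, a context-sensitive grammar keeps the current level of a tree as its sentential form, together with
-- the terminals of earlier levels, and rewrites it cell by cell from left to right. Each new cell records the
-- state of a finite automaton for the control language, which the next cell reads off as left context. The parity
-- of the level, compared with both neighbours, keeps the successive sweeps from overtaking each other.

module Submission where

open import Defs
open import Data.Nat using (ℕ; zero; suc; pred; _<_; _≤_; _⊔_; z≤n; s≤s)
open import Data.Nat.Properties
  using (⊔-assoc; ⊔-identityʳ; mono-≤-distrib-⊔; pred-mono-≤; ≤-reflexive; <-≤-trans; m⊔n≤o⇒m≤o; m⊔n≤o⇒n≤o; ⊔-lub)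
open import Data.Fin using (Fin; splitAt; join; combine; remQuot)
open import Data.Fin.Properties using (splitAt-join; remQuot-combine) renaming (_≟_ to _≟ᶠ_)
open import Data.Bool using (Bool; true; false; not)
open import Data.Bool.Properties using (not-involutive; not-¬)
open import Data.List using (List; []; _∷_; [_]; _++_; map; concatMap; allFin; filter; length; lookup)
open import Data.List.Properties using (++-assoc; ++-identityʳ; map-++; map-∘; map-id; map-cong; ∷-injective; ≡-dec)
open import Data.List.Membership.Propositional using (_∈_; _∉_; find; lose)
open import Data.List.Membership.Propositional.Properties
  using (∈-++⁺ˡ; ∈-++⁺ʳ; ∈-++⁻; ∈-map⁺; ∈-map⁻; ∈-filter⁺; ∈-filter⁻; ∈-lookup; ∈-allFin; ∈-concatMap⁺; ∈-concatMap⁻)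
open import Data.List.Relation.Unary.All using (All; []; _∷_)
open import Data.List.Relation.Unary.Any using (here; there; any?; index)
open import Data.List.Relation.Unary.Any.Properties using (lookup-index)
open import Data.Sum using (_⊎_; inj₁; inj₂) renaming (map to map⊎)
open import Data.Sum.Properties using (inj₁-injective)
open import Data.Product using (_×_; _,_; ∃; proj₁; proj₂) renaming (map to map×)
import Data.Product.Properties as Product
open import Data.Empty using (⊥; ⊥-elim)
open import Data.Unit using (⊤; tt)
open import Function using (_∘_; id)
open import Relation.Nullary using (Dec; yes; no)
open import Relation.Nullary.Decidable using (map′; ¬?; _×-dec_; _⊎-dec_)
open import Relation.Binary.Definitions using (DecidableEquality)
open import Relation.Binary.PropositionalEquality hiding ([_])
open import Relation.Binary.Construct.Closure.ReflexiveTransitive using (Star; ε; _◅_; _◅◅_; gmap)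

-- The control sees a level before its symbols are expanded. The check of the context therefore has
-- to happen on a level where the nonterminal already names its rule, which is why selecting and
-- firing a rule are separate levels. Several rules may fire on one level, but only in disjoint
-- blocks whose context symbols keep their meaning, so these firings can be carried out one after
-- another.
--
-- In the converse, a derivation may interleave the sweeps of different levels, and no normal form
-- for derivations is established. Soundness is proved backwards from the terminal word instead.
-- Every gap between two symbols carries the states of the automaton on all levels still to come,
-- and undoing the rewriting of a cell extends the columns of that cell by one state. What has to be
-- shown is that the colours alone tell whether two neighbours are level or one step apart.

-- Finite types and finite listings of predicates

record Finite (A : Set) : Set where
  field
    size    : ℕ
    to      : A → Fin size
    from    : Fin size → A
    from-to : ∀ x → from (to x) ≡ x

  to-injective : ∀ {x y} → to x ≡ to y → x ≡ y
  to-injective {x} {y} eq = trans (sym (from-to x)) (trans (cong from eq) (from-to y))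

  _≟_ : DecidableEquality A
  x ≟ y = map′ to-injective (cong to) (to x ≟ᶠ to y)

  elements : List A
  elements = map from (allFin size)

  ∈-elements : ∀ x → x ∈ elements
  ∈-elements x = subst (_∈ elements) (from-to x) (∈-map⁺ from (∈-allFin (to x)))

  ∃? : ∀ {P : A → Set} → (∀ x → Dec (P x)) → Dec (∃ P)
  ∃? P? = map′ (λ p → let x , _ , px = find p in x , px)
               (λ (x , px) → lose (∈-elements x) px) (any? P? elements)

open Finite using (to; from; from-to; to-injective)

Fin-finite : ∀ n → Finite (Fin n)
Fin-finite n = record { size = n ; to = id ; from = id ; from-to = λ _ → refl }

⊤-finite : Finite ⊤
⊤-finite = record { size = 1 ; to = λ _ → Fin.zero ; from = λ _ → tt ; from-to = λ _ → refl }

_⊎-finite_ : ∀ {A B} → Finite A → Finite B → Finite (A ⊎ B)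
F ⊎-finite G = record
  { to      = join _ _ ∘ map⊎ (to F) (to G)
  ; from    = map⊎ (from F) (from G) ∘ splitAt _
  ; from-to = λ x → trans (cong (map⊎ (from F) (from G)) (splitAt-join _ _ (map⊎ (to F) (to G) x))) (inv x) }
  where
  inv : ∀ x → map⊎ (from F) (from G) (map⊎ (to F) (to G) x) ≡ x
  inv (inj₁ a) = cong inj₁ (from-to F a)
  inv (inj₂ b) = cong inj₂ (from-to G b)

_×-finite_ : ∀ {A B} → Finite A → Finite B → Finite (A × B)
F ×-finite G = record
  { to      = λ (a , b) → combine (to F a) (to G b)
  ; from    = map× (from F) (from G) ∘ remQuot _
  ; from-to = λ (a , b) → trans (cong (map× (from F) (from G)) (remQuot-combine (to F a) (to G b)))
                                (cong₂ _,_ (from-to F a) (from-to G b)) }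

Bool-finite : Finite Bool
Bool-finite = record
  { size    = 2
  ; to      = λ { false → Fin.zero ; true → Fin.suc Fin.zero }
  ; from    = λ { Fin.zero → false ; (Fin.suc _) → true }
  ; from-to = λ { false → refl ; true → refl } }

-- A grammar wants its rules as a list, while the proofs argue by cases on an inductive family; a
-- listing passes from one to the other.
record Listing {A : Set} (P : A → Set) : Set where
  constructor listing
  field
    list     : List A
    sound    : ∀ {x} → x ∈ list → P x
    complete : ∀ {x} → P x → x ∈ list

open Listing

private variable
  C D : Set

⟨_⟩ : (a : C) → Listing (_≡ a)
⟨ a ⟩ = listing [ a ] (λ { (here eq) → eq }) here

_∪_ : ∀ {P Q : C → Set} → Listing P → Listing Q → Listing (λ x → P x ⊎ Q x)
L ∪ M = listing (list L ++ list M) (map⊎ (sound L) (sound M) ∘ ∈-++⁻ (list L))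
  λ { (inj₁ p) → ∈-++⁺ˡ (complete L p) ; (inj₂ q) → ∈-++⁺ʳ (list L) (complete M q) }

_≫=_ : ∀ {P : C → Set} {Q : C → D → Set} →
       Listing P → (∀ a → Listing (Q a)) → Listing (λ b → ∃ λ a → P a × Q a b)
L ≫= M = listing (concatMap (list ∘ M) (list L))
  (λ b∈ → let a , a∈ , b∈' = find (∈-concatMap⁻ (list ∘ M) b∈) in a , sound L a∈ , sound (M a) b∈')
  (λ (a , p , q) → ∈-concatMap⁺ (list ∘ M) (lose (complete L p) (complete (M a) q)))

guard : ∀ {G : Set} {P : C → Set} → Dec G → Listing P → Listing (λ x → G × P x)
guard (yes g) L = listing (list L) (λ x∈ → g , sound L x∈) (λ (_ , p) → complete L p)
guard (no ¬g) L = listing [] (λ ()) (λ (g , _) → ⊥-elim (¬g g))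

reindex : ∀ {P Q : C → Set} → (∀ {x} → P x → Q x) → (∀ {x} → Q x → P x) → Listing P → Listing Q
reindex f g L = listing (list L) (f ∘ sound L) (complete L ∘ g)

members : (xs : List C) → Listing (_∈ xs)
members xs = listing xs id id

every : Finite C → Listing {C} (λ _ → ⊤)
every F = listing (Finite.elements F) (λ _ → tt) (λ {x} _ → Finite.∈-elements F x)

-- Union-free expressions for tilings by blocks

-- The empty word has no expression of its own; `∅ *` denotes it.
word : List C → UFExp C
word []      = ∅ *
word (a ∷ w) = lit a · word w

∈-word : ∀ (w : List C) → ⟦ word w ⟧ w
∈-word []      = nil
∈-word (a ∷ w) = cat lit (∈-word w)

word-unique : ∀ (w : List C) {v} → ⟦ word w ⟧ v → v ≡ w
word-unique []      nil         = refl
word-unique []      (more () _)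
word-unique (a ∷ w) (cat lit p) = cong (a ∷_) (word-unique w p)

data Tiling (bs : List (List C)) : List C → Set where
  []  : Tiling bs []
  _∷_ : ∀ {b w} → b ∈ bs → Tiling bs w → Tiling bs (b ++ w)

_++ᵗ_ : ∀ {bs : List (List C)} {u v} → Tiling bs u → Tiling bs v → Tiling bs (u ++ v)
[]      ++ᵗ q = q
_++ᵗ_ {bs = bs} (_∷_ {b} {w} b∈ p) q = subst (Tiling bs) (sym (++-assoc b w _)) (b∈ ∷ (p ++ᵗ q))

stars : List (List C) → UFExp C
stars []       = ∅ *
stars (b ∷ bs) = (word b *) · stars bs

tilings : List (List C) → UFExp C
tilings bs = stars bs *

star-tiling : ∀ {bs : List (List C)} {e} → (∀ {v} → ⟦ e ⟧ v → Tiling bs v) → ∀ {v} → ⟦ e * ⟧ v → Tiling bs v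
star-tiling f nil        = []
star-tiling f (more p q) = f p ++ᵗ star-tiling f q

stars-tiling : ∀ {bs} (cs : List (List C)) → (∀ {b} → b ∈ cs → b ∈ bs) → ∀ {v} → ⟦ stars cs ⟧ v → Tiling bs v
stars-tiling []       _ nil         = []
stars-tiling []       _ (more () _)
stars-tiling {bs = bs} (b ∷ cs) cs⊆ (cat p q) = star-tiling one p ++ᵗ stars-tiling cs (cs⊆ ∘ there) q
  where
  one : ∀ {v} → ⟦ word b ⟧ v → Tiling bs v
  one r rewrite word-unique b r = subst (Tiling bs) (++-identityʳ b) (cs⊆ (here refl) ∷ [])

tilings-sound : ∀ (bs : List (List C)) {v} → ⟦ tilings bs ⟧ v → Tiling bs v
tilings-sound bs = star-tiling (stars-tiling bs id)

[]∈stars : ∀ (bs : List (List C)) → ⟦ stars bs ⟧ []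
[]∈stars []       = nil
[]∈stars (b ∷ bs) = cat nil ([]∈stars bs)

block∈stars : ∀ {bs : List (List C)} {b} → b ∈ bs → ⟦ stars bs ⟧ b
block∈stars {bs = b ∷ bs} (here refl) =
  subst ⟦ stars (b ∷ bs) ⟧ (trans (++-identityʳ _) (++-identityʳ b)) (cat (more (∈-word b) nil) ([]∈stars bs))
block∈stars (there b∈) = cat nil (block∈stars b∈)

tilings-complete : ∀ {bs : List (List C)} {v} → Tiling bs v → ⟦ tilings bs ⟧ v
tilings-complete []       = nil
tilings-complete (b∈ ∷ p) = more (block∈stars b∈) (tilings-complete p)

-- Derivations of a context-sensitive grammar

module _ {k} (G : CSG k) where
  open CSG G using (_⇒_; step)

  Derives : List (Sym (CSG.m G) k) → List (Sym (CSG.m G) k) → Set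
  Derives = Star _⇒_

  private
    regroup : ∀ {C : Set} (p p' l q' q : List C) → p ++ (p' ++ l ++ q') ++ q ≡ (p ++ p') ++ l ++ (q' ++ q)
    regroup p p' l q' q = begin
      p ++ (p' ++ l ++ q') ++ q   ≡⟨ cong (p ++_) (++-assoc p' (l ++ q') q) ⟩
      p ++ p' ++ (l ++ q') ++ q   ≡⟨ cong (λ z → p ++ p' ++ z) (++-assoc l q' q) ⟩
      p ++ p' ++ l ++ q' ++ q     ≡⟨ ++-assoc p p' _ ⟨
      (p ++ p') ++ l ++ q' ++ q   ∎
      where open ≡-Reasoning

  ⇒-cong : ∀ p q {u v} → u ⇒ v → (p ++ u ++ q) ⇒ (p ++ v ++ q)
  ⇒-cong p q (step {r} p' q' r∈) =
    subst₂ _⇒_ (sym (regroup p p' (CSRule.lhs r) q' q)) (sym (regroup p p' (CSRule.rhs r) q' q))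
      (step (p ++ p') (q' ++ q) r∈)

  ⇒*-cong : ∀ p q {u v} → Derives u v → Derives (p ++ u ++ q) (p ++ v ++ q)
  ⇒*-cong p q = gmap (λ u → p ++ u ++ q) (⇒-cong p q)

  ⇒*-++ : ∀ {u u' v v'} → Derives u u' → Derives v v' → Derives (u ++ v) (u' ++ v')
  ⇒*-++ {u} {u'} {v} {v'} d e =
    ⇒*-cong [] v d ◅◅ subst₂ Derives (cong (u' ++_) (++-identityʳ v)) (cong (u' ++_) (++-identityʳ v')) (⇒*-cong u' [] e)

  ⇒*-rule : ∀ {r} → r ∈ CSG.P G → Derives (CSRule.lhs r) (CSRule.rhs r)
  ⇒*-rule r∈ = subst₂ Derives (++-identityʳ _) (++-identityʳ _) (step [] [] r∈ ◅ ε)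

Tiling-map⁺ : ∀ (f : C → D) {bs w} → Tiling bs w → Tiling (map (map f) bs) (map f w)
Tiling-map⁺ f []                  = []
Tiling-map⁺ f (_∷_ {b} {w} b∈ t) rewrite map-++ f b w = ∈-map⁺ (map f) b∈ ∷ Tiling-map⁺ f t

Tiling-map⁻ : ∀ (f : C → D) {bs v} → Tiling (map (map f) bs) v → ∃ λ w → v ≡ map f w × Tiling bs w
Tiling-map⁻ f []       = [] , refl , []
Tiling-map⁻ f (b∈ ∷ t) with ∈-map⁻ (map f) b∈ | Tiling-map⁻ f t
... | b , b∈' , refl | w , refl , t' = b ++ w , sym (map-++ f b w) , b∈' ∷ t'

map-≡-++ : ∀ (f : C → D) xs {ys zs} → map f xs ≡ ys ++ zs →
           ∃ λ us → ∃ λ vs → xs ≡ us ++ vs × map f us ≡ ys × map f vs ≡ zs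
map-≡-++ f xs       {[]}     eq = [] , xs , refl , refl , eq
map-≡-++ f (x ∷ xs) {y ∷ ys} eq with ∷-injective eq
... | refl , eq' with map-≡-++ f xs {ys} eq'
... | us , vs , refl , refl , eq″ = x ∷ us , vs , refl , refl , eq″

null? : (xs : List C) → Dec (xs ≡ [])
null? []      = yes refl
null? (_ ∷ _) = no λ ()

-- Forests, their levels and their offspring

module _ {m k : ℕ} where

  private
    T = Tree {m} {k}

  levels-zero : ∀ (ts : List T) → levels 0 ts ≡ map label ts
  levels-zero []       = refl
  levels-zero (t ∷ ts) = cong (label t ∷_) (levels-zero ts)

  levels-++ : ∀ j (ts us : List T) → levels j (ts ++ us) ≡ levels j ts ++ levels j us
  levels-++ j []       us = refl
  levels-++ j (t ∷ ts) us =
    trans (cong (level j t ++_) (levels-++ j ts us)) (sym (++-assoc (level j t) _ _))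

  yields-++ : ∀ (ts us : List T) → yields (ts ++ us) ≡ yields ts ++ yields us
  yields-++ []       us = refl
  yields-++ (t ∷ ts) us = trans (cong (yield t ++_) (yields-++ ts us)) (sym (++-assoc (yield t) _ _))

  heights-++ : ∀ (ts us : List T) → heights (ts ++ us) ≡ heights ts ⊔ heights us
  heights-++ []       us = refl
  heights-++ (t ∷ ts) us =
    trans (cong (height t ⊔_) (heights-++ ts us)) (sym (⊔-assoc (height t) (heights ts) (heights us)))

  AllValid-++⁺ : ∀ {P} (ts : List T) {us} → AllValid P ts → AllValid P us → AllValid P (ts ++ us)
  AllValid-++⁺ []       _         vs = vs
  AllValid-++⁺ (t ∷ ts) (v , vt) vs = v , AllValid-++⁺ ts vt vs

  AllValid-++⁻ : ∀ {P} (ts : List T) {us} → AllValid P (ts ++ us) → AllValid P ts × AllValid P us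
  AllValid-++⁻ []       vs       = tt , vs
  AllValid-++⁻ (t ∷ ts) (v , vs) = let vt , vu = AllValid-++⁻ ts vs in (v , vt) , vu

  children : T → List T
  children (leaf _)    = []
  children (node _ ts) = ts
  children (nodeλ _)   = []

  -- Removing the roots moves every level up by one, so induction on the height runs over forests.
  -- Roots that are leaves disappear together with their letters.
  offspring : List T → List T
  offspring = concatMap children

  level-suc : ∀ j t → level (suc j) t ≡ levels j (children t)
  level-suc j (leaf _)   = refl
  level-suc j (node _ _) = refl
  level-suc j (nodeλ _)  = refl

  levels-suc : ∀ j ts → levels (suc j) ts ≡ levels j (offspring ts)
  levels-suc j []       = refl
  levels-suc j (t ∷ ts) =
    trans (cong₂ _++_ (level-suc j t) (levels-suc j ts)) (sym (levels-++ j (children t) (offspring ts)))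

  heights-children : ∀ t → heights (children t) ≡ pred (height t)
  heights-children (leaf _)   = refl
  heights-children (node _ _) = refl
  heights-children (nodeλ _)  = refl

  heights-offspring : ∀ ts → heights (offspring ts) ≡ pred (heights ts)
  heights-offspring []       = refl
  heights-offspring (t ∷ ts) = begin
    heights (children t ++ offspring ts)             ≡⟨ heights-++ (children t) (offspring ts) ⟩
    heights (children t) ⊔ heights (offspring ts)    ≡⟨ cong₂ _⊔_ (heights-children t) (heights-offspring ts) ⟩
    pred (height t) ⊔ pred (heights ts)              ≡⟨ mono-≤-distrib-⊔ pred-mono-≤ (height t) (heights ts) ⟨
    pred (height t ⊔ heights ts)                     ∎
    where open ≡-Reasoning

  AllValid-offspring : ∀ {P} ts → AllValid P ts → AllValid P (offspring ts)
  AllValid-offspring []       _        = tt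
  AllValid-offspring (t ∷ ts) (v , vs) = AllValid-++⁺ (children t) (one t v) (AllValid-offspring ts vs)
    where
    one : ∀ {P} t → Valid P t → AllValid P (children t)
    one (leaf _)   _           = tt
    one (node _ _) (_ , _ , v) = v
    one (nodeλ _)  _           = tt

-- From context-sensitive grammars to tree control

module FromCS {k} (G : CSG k) where
  open CSG G hiding (lang)
  open CSRule

  private
    V = Sym m k

    infix 4 _⇒*_
    _⇒*_ = Derives G

  Erasing : Set
  Erasing = ∃ λ r → r ∈ P × γ r ≡ []

  erasing? : Dec Erasing
  erasing? = map′ find (λ (_ , r∈ , e) → lose r∈ e) (any? (λ r → null? (γ r)) P)

  P⁺ : List (CSRule m k)
  P⁺ = filter (λ r → ¬? (null? (γ r))) P

  rule : Fin (length P⁺) → CSRule m k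
  rule = lookup P⁺

  rule∈ : ∀ i → rule i ∈ P
  rule∈ i = proj₁ (∈-filter⁻ (λ r → ¬? (null? (γ r))) {xs = P} (∈-lookup i))

  rule-γ : ∀ i → γ (rule i) ≢ []
  rule-γ i = proj₂ (∈-filter⁻ (λ r → ¬? (null? (γ r))) {xs = P} (∈-lookup i))

  rule-onto : ∀ {r} → r ∈ P → γ r ≢ [] → ∃ λ i → rule i ≡ r
  rule-onto r∈ ne = index r∈⁺ , sym (lookup-index r∈⁺)
    where r∈⁺ = ∈-filter⁺ (λ r → ¬? (null? (γ r))) r∈ ne

  -- active i stands for the nonterminal that rule i is about to rewrite
  N : Set
  N = ⊤ ⊎ (V ⊎ Fin (length P⁺))

  pattern start    = inj₁ tt
  pattern plain x  = inj₂ (inj₁ x)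
  pattern active i = inj₂ (inj₂ i)

  V-finite : Finite V
  V-finite = Fin-finite m ⊎-finite Fin-finite k

  abstract
    N-finite : Finite N
    N-finite = ⊤-finite ⊎-finite (V-finite ⊎-finite Fin-finite _)

  M : ℕ
  M = Finite.size N-finite

  code : N → Sym M k
  code = inj₁ ∘ to N-finite

  code-injective : ∀ {x y} → code x ≡ code y → x ≡ y
  code-injective = to-injective N-finite ∘ inj₁-injective

  plainˢ : V → N
  plainˢ x = plain x

  data Rule : N → List (Sym M k) → Set where
    init   : Rule start [ code (plain (inj₁ S)) ]
    erase  : Erasing → Rule start []
    copy   : ∀ x → Rule (plain x) [ code (plain x) ]
    emit   : ∀ a → Rule (plain (inj₂ a)) [ inj₂ a ]
    select : ∀ i → Rule (plain (inj₁ (A (rule i)))) [ code (active i) ]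
    fire   : ∀ i → Rule (active i) (map (code ∘ plainˢ) (γ (rule i)))

  IsRule : Fin M × List (Sym M k) → Set
  IsRule (i , β) = ∃ λ n → i ≡ to N-finite n × Rule n β

  abstract
    rules : Listing IsRule
    rules = reindex
      (λ { (inj₁ refl)                                            → _ , refl , init
         ; (inj₂ (inj₁ (e , refl)))                               → _ , refl , erase e
         ; (inj₂ (inj₂ (inj₁ (x , _ , refl))))                    → _ , refl , copy x
         ; (inj₂ (inj₂ (inj₂ (inj₁ (a , _ , refl)))))             → _ , refl , emit a
         ; (inj₂ (inj₂ (inj₂ (inj₂ (i , _ , inj₁ refl)))))        → _ , refl , select i
         ; (inj₂ (inj₂ (inj₂ (inj₂ (i , _ , inj₂ refl)))))        → _ , refl , fire i })
      (λ { (_ , refl , init)     → inj₁ refl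
         ; (_ , refl , erase e)  → inj₂ (inj₁ (e , refl))
         ; (_ , refl , copy x)   → inj₂ (inj₂ (inj₁ (x , tt , refl)))
         ; (_ , refl , emit a)   → inj₂ (inj₂ (inj₂ (inj₁ (a , tt , refl))))
         ; (_ , refl , select i) → inj₂ (inj₂ (inj₂ (inj₂ (i , tt , inj₁ refl))))
         ; (_ , refl , fire i)   → inj₂ (inj₂ (inj₂ (inj₂ (i , tt , inj₂ refl)))) })
      (⟨ _ ⟩ ∪ (guard erasing? ⟨ _ ⟩ ∪ ((every V-finite ≫= λ x → ⟨ _ ⟩) ∪
        ((every (Fin-finite k) ≫= λ a → ⟨ _ ⟩) ∪ (every (Fin-finite _) ≫= λ i → ⟨ _ ⟩ ∪ ⟨ _ ⟩)))))

  context : Fin (length P⁺) → List N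
  context i = map plainˢ (left (rule i)) ++ active i ∷ map plainˢ (right (rule i))

  data Block : List N → Set where
    start-block   : Block [ start ]
    plain-block   : ∀ x → Block [ plain x ]
    context-block : ∀ i → Block (context i)

  abstract
    blocks : Listing Block
    blocks = reindex
      (λ { (inj₁ refl) → start-block
         ; (inj₂ (inj₁ (x , _ , refl))) → plain-block x
         ; (inj₂ (inj₂ (i , _ , refl))) → context-block i })
      (λ { start-block       → inj₁ refl
         ; (plain-block x)   → inj₂ (inj₁ (x , tt , refl))
         ; (context-block i) → inj₂ (inj₂ (i , tt , refl)) })
      (⟨ _ ⟩ ∪ ((every V-finite ≫= λ x → ⟨ _ ⟩) ∪ (every (Fin-finite _) ≫= λ i → ⟨ _ ⟩)))

  -- No block contains a terminal, so terminals can occur on the last level only. On an earlier one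
  -- an emitted terminal would be missing from the next level, and symbols that are not neighbours
  -- in the sentential form would meet there.
  control : UFExp (Sym M k)
  control = tilings (map (map code) (list blocks))

  -- This is what the separate start symbol is for: `copy` puts every `plain x` on a right-hand
  -- side, also the one for `S`, so none of these could be erased.
  start∉rhs : ∀ {n β} → Rule n β → code start ∉ β
  start∉rhs init       (here eq) with () ← code-injective {start} {plain (inj₁ S)} eq
  start∉rhs (copy x)   (here eq) with () ← code-injective {start} {plain x} eq
  start∉rhs (emit a)   (here ())
  start∉rhs (select i) (here eq) with () ← code-injective {start} {active i} eq
  start∉rhs (fire i)   s∈ with ∈-map⁻ (code ∘ plainˢ) s∈
  ... | x , _ , eq with () ← code-injective {start} {plain x} eq

  rule-wf : ∀ {n β} → Rule n β → β ≢ [] ⊎ (n ≡ start × β ≡ [])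
  rule-wf init       = inj₁ λ ()
  rule-wf (erase _)  = inj₂ (refl , refl)
  rule-wf (copy _)   = inj₁ λ ()
  rule-wf (emit _)   = inj₁ λ ()
  rule-wf (select _) = inj₁ λ ()
  rule-wf (fire i)   = inj₁ (ne (rule-γ i))
    where
    ne : ∀ {w : List V} → w ≢ [] → map (code ∘ plainˢ) w ≢ []
    ne {[]}    w≢ _ = w≢ refl
    ne {_ ∷ _} _  ()

  grammar : TCG k
  grammar = record
    { m = M ; S = to N-finite start ; P = list rules ; R = control
    ; wf = λ r∈ → wf' (sound rules r∈) }
    where
    wf' : ∀ {i β} → IsRule (i , β) → _
    wf' (n , refl , r) with rule-wf r
    ... | inj₁ ne            = inj₁ ne
    ... | inj₂ (refl , refl) = inj₂ (refl , refl , λ {_} {_} r∈ → let _ , _ , r' = sound rules r∈ in start∉rhs r')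

  -- Soundness: levels read as sentential forms

  infix 4 _⟿_
  data _⟿_ : List N → List (Sym M k) → Set where
    []  : [] ⟿ []
    _∷_ : ∀ {n β w v} → Rule n β → w ⟿ v → n ∷ w ⟿ β ++ v

  _++ʳ_ : ∀ {w v w' v'} → w ⟿ v → w' ⟿ v' → w ++ w' ⟿ v ++ v'
  []                    ++ʳ e = e
  _++ʳ_ {v' = v'} (_∷_ {n} {β} {w} {v} r d) e = subst (_ ⟿_) (sym (++-assoc β v v')) (r ∷ (d ++ʳ e))

  -- An `active i` still counts as the nonterminal that rule `i` is going to rewrite. With this
  -- reading `init`, `copy`, `emit` and `select` leave the decoded word unchanged; only `fire` and
  -- `erase` correspond to steps of `G`.
  decode : N → V
  decode start      = inj₁ S
  decode (plain x)  = x
  decode (active i) = inj₁ (A (rule i))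

  decodeˢ : Sym M k → V
  decodeˢ (inj₁ i) = decode (from N-finite i)
  decodeˢ (inj₂ a) = inj₂ a

  decodeˢ-code : ∀ n → decodeˢ (code n) ≡ decode n
  decodeˢ-code n = cong decode (from-to N-finite n)

  map-decodeˢ-code : ∀ w → map decodeˢ (map code w) ≡ map decode w
  map-decodeˢ-code w = trans (sym (map-∘ w)) (map-cong decodeˢ-code w)

  map-decode-plain : ∀ u → map decode (map plainˢ u) ≡ u
  map-decode-plain u = trans (sym (map-∘ u)) (map-id u)

  erase-step : Erasing → [ inj₁ S ] ⇒* []
  erase-step (r , r∈ , γ≡[]) with wf r∈
  ... | inj₁ ne = ⊥-elim (ne γ≡[])
  ... | inj₂ (l≡ , A≡ , r≡ , _) = subst₂ _⇒*_ lhs≡ rhs≡ (⇒*-rule G r∈)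
    where
    lhs≡ : lhs r ≡ [ inj₁ S ]
    lhs≡ rewrite l≡ | A≡ | r≡ = refl
    rhs≡ : rhs r ≡ []
    rhs≡ rewrite l≡ | γ≡[] | r≡ = refl

  plain-rule : ∀ {x β} → Rule (plain x) β → map decodeˢ β ≡ [ x ]
  plain-rule (copy x)   = cong [_] (decodeˢ-code (plain x))
  plain-rule (emit a)   = refl
  plain-rule (select i) = cong [_] (decodeˢ-code (active i))

  start-rule : ∀ {β} → Rule start β → [ inj₁ S ] ⇒* map decodeˢ β
  start-rule init      = subst (λ s → [ inj₁ S ] ⇒* [ s ]) (sym (decodeˢ-code (plain (inj₁ S)))) ε
  start-rule (erase e) = erase-step e

  fire-rule : ∀ {i β} → Rule (active i) β → map decodeˢ β ≡ γ (rule i)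
  fire-rule (fire i) =
    trans (cong (map decodeˢ) (map-∘ (γ (rule i))))
      (trans (map-decodeˢ-code (map plainˢ (γ (rule i)))) (map-decode-plain (γ (rule i))))

  plains-⟿ : ∀ u {w v} → map plainˢ u ++ w ⟿ v →
             ∃ λ v₁ → ∃ λ v₂ → v ≡ v₁ ++ v₂ × map decodeˢ v₁ ≡ u × w ⟿ v₂
  plains-⟿ []      d = [] , _ , refl , refl , d
  plains-⟿ (x ∷ u) (_∷_ {β = β} r d) with plains-⟿ u d
  ... | v₁ , v₂ , refl , eq , e =
    β ++ v₁ , v₂ , sym (++-assoc β v₁ v₂) , trans (map-++ decodeˢ β v₁) (cong₂ _++_ (plain-rule r) eq) , e

  -- The context symbols of a block may be copied, emitted or selected on the same level, but each
  -- of these decodes to the same symbol before and after. Hence the block as a whole performs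
  -- exactly one application of its rule.
  block-⟿ : ∀ {b w v} → Block b → b ++ w ⟿ v →
            ∃ λ v₁ → ∃ λ v₂ → v ≡ v₁ ++ v₂ × (map decode b ⇒* map decodeˢ v₁) × w ⟿ v₂
  block-⟿ start-block     (r ∷ d) = _ , _ , refl , start-rule r , d
  block-⟿ (plain-block x) (r ∷ d) = _ , _ , refl , subst ([ x ] ⇒*_) (sym (plain-rule r)) ε , d
  block-⟿ {w = w} (context-block i) d
    with plains-⟿ (left (rule i)) (subst (_⟿ _) (++-assoc (map plainˢ (left (rule i))) _ w) d)
  ... | v₁ , _ , refl , eq₁ , _∷_ {β = β} r d' with plains-⟿ (right (rule i)) d'
  ... | v₃ , v₄ , refl , eq₃ , e =
    v₁ ++ β ++ v₃ , v₄ , reassoc , subst₂ _⇒*_ (sym lhs≡) (sym rhs≡) (⇒*-rule G (rule∈ i)) , e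
    where
    reassoc : v₁ ++ β ++ v₃ ++ v₄ ≡ (v₁ ++ β ++ v₃) ++ v₄
    reassoc = trans (cong (v₁ ++_) (sym (++-assoc β v₃ v₄))) (sym (++-assoc v₁ (β ++ v₃) v₄))
    lhs≡ : map decode (context i) ≡ lhs (rule i)
    lhs≡ = trans (map-++ decode (map plainˢ (left (rule i))) _)
             (cong₂ _++_ (map-decode-plain (left (rule i))) (cong (inj₁ (A (rule i)) ∷_) (map-decode-plain (right (rule i)))))
    rhs≡ : map decodeˢ (v₁ ++ β ++ v₃) ≡ rhs (rule i)
    rhs≡ = trans (map-++ decodeˢ v₁ (β ++ v₃))
             (cong₂ _++_ eq₁ (trans (map-++ decodeˢ β v₃) (cong₂ _++_ (fire-rule r) eq₃)))

  tiling-⟿ : ∀ {w v} → Tiling (list blocks) w → w ⟿ v → map decode w ⇒* map decodeˢ v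
  tiling-⟿ []                      []  = ε
  tiling-⟿ (_∷_ {b} {w} b∈ t) d with block-⟿ (sound blocks b∈) d
  ... | v₁ , v₂ , refl , d₁ , d₂ rewrite map-++ decode b w | map-++ decodeˢ v₁ v₂ =
    ⇒*-++ G d₁ (tiling-⟿ t d₂)

  forest-⟿ : ∀ w ts → AllValid (list rules) ts → map label ts ≡ map code w → w ⟿ map label (offspring ts)
  forest-⟿ []      []       _        _  = []
  forest-⟿ (n ∷ w) (t ∷ ts) (v , vs) eq with ∷-injective eq
  ... | eq₀ , eq' = subst (n ∷ w ⟿_) (sym (map-++ label (children t) (offspring ts)))
                      (root t v eq₀ ∷ forest-⟿ w ts vs eq')
    where
    valid-rule : ∀ {i β} → (i , β) ∈ list rules → inj₁ i ≡ code n → Rule n β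
    valid-rule r∈ eq with sound rules r∈
    ... | n' , refl , r = subst (λ n → Rule n _) (code-injective eq) r
    root : ∀ t → Valid (list rules) t → label t ≡ code n → Rule n (map label (children t))
    root (node _ _) (_ , r∈ , _) = valid-rule r∈
    root (nodeλ _)  r∈           = valid-rule r∈

  leaves : ∀ ts → heights {M} {k} ts ≡ 0 → map label ts ≡ map inj₂ (yields ts)
  leaves []             _  = refl
  leaves (leaf a ∷ ts)  eq = cong (inj₂ a ∷_) (leaves ts eq)
  leaves (node _ _ ∷ ts) eq with heights ts | eq
  ... | zero  | ()
  ... | suc _ | ()
  leaves (nodeλ _ ∷ ts) eq with heights ts | eq
  ... | zero  | ()
  ... | suc _ | ()

  forest-sound : ∀ h ts → heights ts ≡ h → AllValid (list rules) ts →
                 (∀ j → j < h → ⟦ control ⟧ (levels j ts)) →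
                 map decodeˢ (map label ts) ⇒* map inj₂ (yields ts)
  forest-sound zero    ts eq _ _ =
    subst (λ u → map decodeˢ u ⇒* map inj₂ (yields ts)) (sym (leaves ts eq))
      (subst (_⇒* map inj₂ (yields ts)) (map-∘ (yields ts)) ε)
  forest-sound (suc h) ts eq vs lv with tilings-sound _ (lv 0 (s≤s z≤n))
  ... | t with Tiling-map⁻ code t
  ... | w , eq₀ , t' =
    subst (_⇒* _) (sym (trans (cong (map decodeˢ) labels≡) (map-decodeˢ-code w)))
      (tiling-⟿ t' (forest-⟿ w ts vs labels≡) ◅◅
       subst (λ z → map decodeˢ (map label (offspring ts)) ⇒* map inj₂ z) (sym (yields-offspring w ts labels≡))
         (forest-sound h (offspring ts) (trans (heights-offspring ts) (cong pred eq)) (AllValid-offspring ts vs)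
           (λ j j<h → subst ⟦ control ⟧ (levels-suc j ts) (lv (suc j) (s≤s j<h)))))
    where
    labels≡ : map label ts ≡ map code w
    labels≡ = trans (sym (levels-zero ts)) eq₀
    -- Labels of the form `code n` exclude leaves among the roots, so no letter is lost on the way
    -- to the offspring.
    yields-offspring : ∀ w ts → map label ts ≡ map code w → yields ts ≡ yields (offspring ts)
    yields-offspring []      []       _  = refl
    yields-offspring (n ∷ w) (t ∷ ts) eq with ∷-injective eq
    ... | eq₀ , eq' = trans (cong₂ _++_ (root t eq₀) (yields-offspring w ts eq'))
                        (sym (yields-++ (children t) (offspring ts)))
      where
      root : ∀ t → label t ≡ code n → yield t ≡ yields (children t)
      root (node _ _) _ = refl
      root (nodeλ _)  _ = refl

  grammar-sound : ∀ w → TCG.lang grammar w → CSG.lang G w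
  grammar-sound w (t , lab , v , refl , lv) =
    subst₂ _⇒*_ (cong [_] (trans (cong decodeˢ lab) (decodeˢ-code start)))
      (cong (map inj₂) (++-identityʳ (yield t)))
      (forest-sound (height t) [ t ] (⊔-identityʳ (height t)) (v , tt)
        (λ j j< → subst ⟦ control ⟧ (sym (++-identityʳ (level j t))) (lv j j<)))

  -- Completeness: forests built upwards from their leaves

  -- A `bound` on the height replaces the height itself because it grows by exactly one with each
  -- new level, even when the forest is empty.
  record Grown (α : List (Sym M k)) (w : List (Fin k)) : Set where
    constructor grown
    field
      trees  : List (Tree {M} {k})
      labels : map label trees ≡ α
      valid  : AllValid (list rules) trees
      yields≡ : yields trees ≡ w
      bound  : ℕ
      height≤ : heights trees ≤ bound
      levels∈ : ∀ j → j < bound → ⟦ control ⟧ (levels j trees)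

  terminal-forest : ∀ w → Grown (map inj₂ w) w
  terminal-forest w = grown (map leaf w) (sym (map-∘ w)) (valid w) (yields≡ w) 0 (≤-reflexive (flat w)) (λ _ ())
    where
    valid : ∀ w → AllValid (list rules) (map leaf w)
    valid []      = tt
    valid (_ ∷ w) = tt , valid w
    yields≡ : ∀ w → yields {M} {k} (map leaf w) ≡ w
    yields≡ []      = refl
    yields≡ (a ∷ w) = cong (a ∷_) (yields≡ w)
    flat : ∀ w → heights {M} {k} (map leaf w) ≡ 0
    flat []      = refl
    flat (_ ∷ w) = flat w

  attach : ∀ {w β} → w ⟿ β → ∀ ts → map label ts ≡ β → AllValid (list rules) ts →
           ∃ λ us → map label us ≡ map code w × AllValid (list rules) us ×
                    yields us ≡ yields ts × offspring us ≡ ts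
  attach []      []  _  _  = [] , refl , tt , refl , refl
  attach (_∷_ {n} {β} r d) ts eq vs with map-≡-++ label ts {β} eq
  ... | ts₁ , ts₂ , refl , refl , eq₂ with AllValid-++⁻ ts₁ vs
  ... | vs₁ , vs₂ with attach d ts₂ eq₂ vs₂
  ... | us , labels , valid , yields≡ , refl with ts₁
  -- A `node` must have children, so an empty right-hand side calls for `nodeλ`.
  ... | []      = nodeλ _ ∷ us , cong (code n ∷_) labels , (complete rules (n , refl , r) , valid) , yields≡ , refl
  ... | t ∷ ts' = node (to N-finite n) (t ∷ ts') ∷ us , cong (code n ∷_) labels ,
                  (((λ ()) , complete rules (n , refl , r) , vs₁) , valid) ,
                  trans (cong (yields (t ∷ ts') ++_) yields≡) (sym (yields-++ (t ∷ ts') (offspring us))) , refl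

  grow : ∀ {w β z} → Tiling (list blocks) w → w ⟿ β → Grown β z → Grown (map code w) z
  grow {w} t d (grown ts labels valid refl h h≤ lv) with attach d ts labels valid
  ... | us , labels' , valid' , yields≡ , refl =
    grown us labels' valid' yields≡ (suc h) (≤-pred⁻ (subst (_≤ h) (heights-offspring us) h≤)) lv'
    where
    ≤-pred⁻ : ∀ {a b} → pred a ≤ b → a ≤ suc b
    ≤-pred⁻ {zero}  _ = z≤n
    ≤-pred⁻ {suc a} p = s≤s p
    lv' : ∀ j → j < suc h → ⟦ control ⟧ (levels j us)
    lv' zero    _         = subst ⟦ control ⟧ (sym (trans (levels-zero us) labels')) (tilings-complete (Tiling-map⁺ code t))
    lv' (suc j) (s≤s j<h) = subst ⟦ control ⟧ (sym (levels-suc j us)) (lv j j<h)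

  plain-tiling : ∀ u → Tiling (list blocks) (map plainˢ u)
  plain-tiling []      = []
  plain-tiling (x ∷ u) = complete blocks (plain-block x) ∷ plain-tiling u

  copies : ∀ u → map plainˢ u ⟿ map code (map plainˢ u)
  copies []      = []
  copies (x ∷ u) = copy x ∷ copies u

  emits : ∀ w → map plainˢ (map inj₂ w) ⟿ map inj₂ w
  emits []      = []
  emits (a ∷ w) = emit a ∷ emits w

  plainGrown : List V → List (Fin k) → Set
  plainGrown u = Grown (map code (map plainˢ u))

  -- One step of `G` costs two levels. On the upper one all symbols are `plain`, and the nonterminal
  -- of the rule is selected; on the lower one it is `active` inside its context block and fires.
  -- Everything else is copied twice.
  step-forest : ∀ {r} p q → r ∈ P → γ r ≢ [] → ∀ {z} → plainGrown (p ++ rhs r ++ q) z → plainGrown (p ++ lhs r ++ q) z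
  step-forest {r} p q r∈ ne g with rule-onto r∈ ne
  ... | i , refl =
    grow (plain-tiling (p ++ lhs r ++ q)) (subst₂ _⟿_ (sym (spread plainˢ (lhs r))) (sym (code-spread (context i))) (copies p ++ʳ (selecting ++ʳ copies q)))
      (grow (plain-tiling p ++ᵗ (complete blocks (context-block i) ∷ plain-tiling q))
        (subst (map plainˢ p ++ context i ++ map plainˢ q ⟿_) (sym (trans (cong (map code) (spread plainˢ (rhs r))) (code-spread (map plainˢ (rhs r)))))
          (copies p ++ʳ (firing ++ʳ copies q)))
        g)
    where
    spread : ∀ {B : Set} (f : V → B) u → map f (p ++ u ++ q) ≡ map f p ++ map f u ++ map f q
    spread f u = trans (map-++ f p (u ++ q)) (cong (map f p ++_) (map-++ f u q))
    code-spread : ∀ u → map code (map plainˢ p ++ u ++ map plainˢ q) ≡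
                        map code (map plainˢ p) ++ map code u ++ map code (map plainˢ q)
    code-spread u = trans (map-++ code (map plainˢ p) (u ++ map plainˢ q))
                      (cong (map code (map plainˢ p) ++_) (map-++ code u (map plainˢ q)))
    selecting : map plainˢ (lhs r) ⟿ map code (context i)
    selecting = subst₂ _⟿_ (sym (map-++ plainˢ (left r) _)) (sym (map-++ code (map plainˢ (left r)) _))
                  (copies (left r) ++ʳ (select i ∷ copies (right r)))
    firing : context i ⟿ map code (map plainˢ (rhs r))
    firing = subst (context i ⟿_) (sym eq) (copies (left r) ++ʳ (fire i ∷ copies (right r)))
      where
      eq : map code (map plainˢ (left r ++ γ r ++ right r)) ≡
           map code (map plainˢ (left r)) ++ map (code ∘ plainˢ) (γ r) ++ map code (map plainˢ (right r))
      eq = begin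
        map code (map plainˢ (left r ++ γ r ++ right r))                    ≡⟨ map-∘ (rhs r) ⟨
        map f (left r ++ γ r ++ right r)                                    ≡⟨ map-++ f (left r) _ ⟩
        map f (left r) ++ map f (γ r ++ right r)                            ≡⟨ cong (map f (left r) ++_) (map-++ f (γ r) _) ⟩
        map f (left r) ++ map f (γ r) ++ map f (right r)
          ≡⟨ cong₂ (λ x y → x ++ map f (γ r) ++ y) (map-∘ (left r)) (map-∘ (right r)) ⟩
        map code (map plainˢ (left r)) ++ map f (γ r) ++ map code (map plainˢ (right r)) ∎
        where
        open ≡-Reasoning
        f = code ∘ plainˢ

  -- No erasing rule is applicable to u, nor to anything derived from it.
  Unerasable : List V → Set
  Unerasable u = ∀ {r} → r ∈ P → γ r ≡ [] → inj₁ S ∉ u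

  S∉rhs : ∀ {r r'} → r ∈ P → γ r ≡ [] → r' ∈ P → inj₁ S ∉ rhs r'
  S∉rhs r∈ γ≡[] r'∈ with wf r∈
  ... | inj₁ ne                    = ⊥-elim (ne γ≡[])
  ... | inj₂ (_ , _ , _ , _ , S∉) = S∉ r'∈

  unerasable-step : ∀ {r} p q → r ∈ P → Unerasable (p ++ lhs r ++ q) → Unerasable (p ++ rhs r ++ q)
  unerasable-step {r} p q r∈ un e∈ γ≡[] S∈ with ∈-++⁻ p S∈
  ... | inj₁ S∈p = un e∈ γ≡[] (∈-++⁺ˡ S∈p)
  ... | inj₂ S∈' with ∈-++⁻ (rhs r) S∈'
  ... | inj₁ S∈r = S∉rhs e∈ γ≡[] r∈ S∈r
  ... | inj₂ S∈q = un e∈ γ≡[] (∈-++⁺ʳ p (∈-++⁺ʳ (lhs r) S∈q))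

  unerasable-γ : ∀ {r} p q → r ∈ P → Unerasable (p ++ lhs r ++ q) → γ r ≢ []
  unerasable-γ {r} p q r∈ un γ≡[] with wf r∈
  ... | inj₁ ne            = ne γ≡[]
  ... | inj₂ (_ , A≡ , _) =
    un r∈ γ≡[] (∈-++⁺ʳ p (∈-++⁺ˡ (∈-++⁺ʳ (left r) (here (cong inj₁ (sym A≡))))))

  derivation-forest : ∀ {u w} → u ⇒* map inj₂ w → Unerasable u → plainGrown u w
  derivation-forest {w = w} d = go d refl
    where
    go : ∀ {u v} → u ⇒* v → v ≡ map inj₂ w → Unerasable u → plainGrown u w
    -- Letters stay `plain` throughout the simulation; one additional level emits all of them at
    -- once.
    go ε                  refl un = grow (plain-tiling (map inj₂ w)) (emits w) (terminal-forest w)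
    go (step p q r∈ ◅ d) eq   un =
      step-forest p q r∈ (unerasable-γ p q r∈ un) (go d eq (unerasable-step p q r∈ un))

  singleton-split : ∀ {x y : V} p l {r q} → p ++ (l ++ x ∷ r) ++ q ≡ [ y ] → p ≡ [] × q ≡ []
  singleton-split []      []      {[]}    {[]}    eq = refl , refl
  singleton-split []      []      {[]}    {_ ∷ _} ()
  singleton-split []      []      {_ ∷ _}         ()
  singleton-split []      (_ ∷ [])    ()
  singleton-split []      (_ ∷ _ ∷ _) ()
  singleton-split (_ ∷ [])    []      ()
  singleton-split (_ ∷ [])    (_ ∷ _) ()
  singleton-split (_ ∷ _ ∷ _) _       ()

  []-irreducible : ∀ {u} → [] ⇒* u → u ≡ []
  []-irreducible d = go d refl
    where
    nonempty : ∀ p l {x : V} {r q} → [] ≢ p ++ (l ++ x ∷ r) ++ q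
    nonempty []      []      ()
    nonempty []      (_ ∷ _) ()
    nonempty (_ ∷ _) _       ()
    go : ∀ {v u} → v ⇒* u → v ≡ [] → u ≡ []
    go ε                      eq = eq
    go (step {r} p q _ ◅ _) eq = ⊥-elim (nonempty p (left r) (sym eq))

  -- Only the first step of a derivation can erase: if `G` has an erasing rule, `S` is on no
  -- right-hand side and is gone after that step. The first step is therefore treated apart, and the
  -- remainder starts from an unerasable word.
  start-forest : ∀ {w} → [ inj₁ S ] ⇒* map inj₂ w → Grown [ code start ] w
  start-forest {w} d = go d refl refl
    where
    start-tiling : Tiling (list blocks) [ start ]
    start-tiling = complete blocks start-block ∷ []
    go : ∀ {u v} → u ⇒* v → u ≡ [ inj₁ S ] → v ≡ map inj₂ w → Grown [ code start ] w
    go ε eq eq' = ⊥-elim (nonterminal w (trans (sym eq) eq'))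
      where
      nonterminal : ∀ w → [ inj₁ S ] ≢ map inj₂ w
      nonterminal []      ()
      nonterminal (_ ∷ _) ()
    go (step {r} p q r∈ ◅ d) eq refl with singleton-split p (left r) eq | null? (γ r)
    ... | refl , refl | yes γ≡[] = finish w (subst (_⇒* map inj₂ w) rhs≡ d)
      where
      rhs≡ : rhs r ++ [] ≡ []
      rhs≡ with wf r∈
      ... | inj₁ ne                 = ⊥-elim (ne γ≡[])
      ... | inj₂ (l≡ , _ , r≡ , _) rewrite l≡ | γ≡[] | r≡ = refl
      finish : ∀ w → [] ⇒* map inj₂ w → Grown [ code start ] w
      finish [] _ = grow start-tiling (erase (r , r∈ , γ≡[]) ∷ []) (terminal-forest [])
      finish (_ ∷ _) d with () ← []-irreducible d
    ... | refl , refl | no ne =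
      grow start-tiling (init ∷ []) (subst (λ u → plainGrown u w) eq
        (step-forest [] [] r∈ ne (derivation-forest d un)))
      where
      un : Unerasable (rhs r ++ [])
      un e∈ γ≡[] S∈ = S∉rhs e∈ γ≡[] r∈ (subst (inj₁ S ∈_) (++-identityʳ (rhs r)) S∈)

  grammar-complete : ∀ w → CSG.lang G w → TCG.lang grammar w
  grammar-complete w d with start-forest d
  ... | grown (t ∷ []) labels (v , _) refl h h≤ lv =
    t , proj₁ (∷-injective labels) , v , sym (++-identityʳ (yield t)) ,
    λ j j< → subst ⟦ control ⟧ (++-identityʳ (level j t))
      (lv j (<-≤-trans j< (subst (_≤ h) (⊔-identityʳ (height t)) h≤)))

-- From level-by-level growth to context-sensitive grammars

-- `Expand (x , q , q' , β)` says that `x` takes the control automaton from `q` to `q'` on its own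
-- level and has `β` below it. Since `β` is never empty, a sentential form that holds a whole level
-- does not shrink.
record Levelled (k : ℕ) : Set₁ where
  field
    X Q      : Set
    X-finite : Finite X
    Q-finite : Finite Q
    Expand   : X × Q × Q × List X → Set
    expands  : Listing Expand
    expand≢[] : ∀ {x q q' β} → Expand (x , q , q' , β) → β ≢ []
    Halt     : X × Fin k → Set
    halts    : Listing Halt
    x₀       : X
    q₀       : Q
    Final    : Q → Set
    Final?   : ∀ q → Dec (Final q)
    Empty    : Set
    Empty?   : Dec Empty

  -- Grow x c c' w: some tree with root x and yield w has, at each level j, a word on which
  -- the control automaton can go from the j-th state of c to the j-th state of c'.
  mutual
    data Grow : X → List Q → List Q → List (Fin k) → Set where
      stop : ∀ {x a} → Halt (x , a) → Grow x [] [] [ a ]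
      step : ∀ {x q q' β c c' w} → Expand (x , q , q' , β) → Grows β c c' w → Grow x (q ∷ c) (q' ∷ c') w

    -- The column that leaves one tree enters the next, on all levels at once; in this way the
    -- automaton runs along every level without the levels being formed. As `stop` requires empty
    -- columns, all branches end on the same level.
    data Grows : List X → List Q → List Q → List (Fin k) → Set where
      []  : ∀ {c} → Grows [] c c []
      _∷_ : ∀ {x xs c c' c″ u v} → Grow x c c' u → Grows xs c' c″ v → Grows (x ∷ xs) c c″ (u ++ v)

  data Generates : List (Fin k) → Set where
    empty : Empty → Generates []
    grows : ∀ {c c' w} → All (_≡ q₀) c → All Final c' → Grow x₀ c c' w → Generates w

module FromLevelled {k} (L : Levelled k) where
  open Levelled L

  Cell : Set
  Cell = Bool × Bool × X × Bool × Q

  N : Set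
  N = ⊤ ⊎ Cell

  abstract
    N-finite : Finite N
    N-finite = ⊤-finite ⊎-finite (Bool-finite ×-finite (Bool-finite ×-finite
                 (X-finite ×-finite (Bool-finite ×-finite Q-finite))))

  M : ℕ
  M = Finite.size N-finite

  V : Set
  V = Sym M k

  start : Fin M
  start = to N-finite (inj₁ tt)

  -- cell f l x c q: f and l mark the first and the last cell of the sentential form, the colour c
  -- alternates from level to level and is guessed at the start so as to be true on the last one, and q is the
  -- state in which the control automaton left the parent of x.
  cellᶠ : Bool → Bool → X → Bool → Q → Fin M
  cellᶠ f l x c q = to N-finite (inj₂ (f , l , x , c , q))

  cell : Bool → Bool → X → Bool → Q → V
  cell f l x c q = inj₁ (cellᶠ f l x c q)

  row : Bool → Bool → Bool → List (X × Q) → List V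
  row f l c []                  = []
  row f l c ((x , q) ∷ [])      = [ cell f l x c q ]
  row f l c ((x , q) ∷ z ∷ zs) = cell f false x c q ∷ row false l c (z ∷ zs)

  recording : Q → List X → List (X × Q)
  recording q = map (_, q)

  -- The left neighbour must already be on the next level, hence the colour `not c`; its record is
  -- the state in which the automaton reaches the cell.
  data LeftContext (c : Bool) (q : Q) : Bool × List V → Set where
    leftmost : q ≡ q₀ → LeftContext c q (true , [])
    after    : ∀ f y → LeftContext c q (false , [ cell f false y (not c) q ])

  -- The right neighbour must still wait on the level of the cell. At the right end, acceptance of
  -- the level is checked instead.
  data RightContext (c : Bool) (q : Q) : Bool × List V → Set where
    rightmost : Final q → RightContext c q (true , [])
    before    : ∀ l z q' → RightContext c q (false , [ cell false l z c q' ])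

  data Rule : CSRule M k → Set where
    init  : ∀ c q → Rule (csrule [] start [] [ cell true true x₀ c q ])
    erase : Empty → Rule (csrule [] start [] [])
    -- Halting is synchronised without any context. A neighbour that is one level apart has colour
    -- `false`; it cannot halt, and it cannot shift either, because no terminal serves as a context.
    halt  : ∀ f l q {x a} → Halt (x , a) → Rule (csrule [] (cellᶠ f l x true q) [] [ inj₂ a ])
    shift : ∀ {x q q' β} c p {f u l v} → Expand (x , q , q' , β) → LeftContext c q (f , u) → RightContext c q' (l , v) →
            Rule (csrule u (cellᶠ f l x c p) v (row f l (not c) (recording q' β)))

  private
    bools = every Bool-finite

  leftContexts : ∀ c q → Listing (LeftContext c q)
  leftContexts c q = reindex
    (λ { (inj₁ (eq , refl)) → leftmost eq ; (inj₂ (f , _ , y , _ , refl)) → after f y })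
    (λ { (leftmost eq) → inj₁ (eq , refl) ; (after f y) → inj₂ (f , tt , y , tt , refl) })
    (guard (Finite._≟_ Q-finite q q₀) ⟨ _ ⟩ ∪ (bools ≫= λ f → every X-finite ≫= λ y → ⟨ _ ⟩))

  rightContexts : ∀ c q → Listing (RightContext c q)
  rightContexts c q = reindex
    (λ { (inj₁ (fin , refl)) → rightmost fin ; (inj₂ (l , _ , z , _ , q' , _ , refl)) → before l z q' })
    (λ { (rightmost fin) → inj₁ (fin , refl) ; (before l z q') → inj₂ (l , tt , z , tt , q' , tt , refl) })
    (guard (Final? q) ⟨ _ ⟩ ∪ (bools ≫= λ l → every X-finite ≫= λ z → every Q-finite ≫= λ q' → ⟨ _ ⟩))

  abstract
    rules : Listing Rule
    rules = reindex
      (λ { (inj₁ (c , _ , q , _ , refl)) → init c q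
         ; (inj₂ (inj₁ (e , refl))) → erase e
         ; (inj₂ (inj₂ (inj₁ (f , _ , l , _ , q , _ , _ , h , refl)))) → halt f l q h
         ; (inj₂ (inj₂ (inj₂ (c , _ , p , _ , _ , e , _ , u , _ , v , refl)))) → shift c p e u v })
      (λ { (init c q)      → inj₁ (c , tt , q , tt , refl)
         ; (erase e)       → inj₂ (inj₁ (e , refl))
         ; (halt f l q h)  → inj₂ (inj₂ (inj₁ (f , tt , l , tt , q , tt , _ , h , refl)))
         ; (shift c p e u v) → inj₂ (inj₂ (inj₂ (c , tt , p , tt , _ , e , _ , u , _ , v , refl))) })
      ((bools ≫= λ c → every Q-finite ≫= λ q → ⟨ _ ⟩) ∪
       (guard Empty? ⟨ _ ⟩ ∪
       ((bools ≫= λ f → bools ≫= λ l → every Q-finite ≫= λ q → halts ≫= λ { (x , a) → ⟨ csrule [] (cellᶠ f l x true q) [] [ inj₂ a ] ⟩ }) ∪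
        (bools ≫= λ c → every Q-finite ≫= λ p → expands ≫= λ { (x , q , q' , β) →
          leftContexts c q ≫= λ { (f , u) → rightContexts c q' ≫= λ { (l , v) →
            ⟨ csrule u (cellᶠ f l x c p) v (row f l (not c) (recording q' β)) ⟩ } } }))))

  row≢[] : ∀ f l c {zs} → zs ≢ [] → row f l c zs ≢ []
  row≢[] f l c {[]}         zs≢[] _ = zs≢[] refl
  row≢[] f l c {_ ∷ []}     _ ()
  row≢[] f l c {_ ∷ _ ∷ _} _ ()

  recording≢[] : ∀ q {β} → β ≢ [] → recording q β ≢ []
  recording≢[] q {[]}    β≢[] _ = β≢[] refl
  recording≢[] q {_ ∷ _} _ ()

  start≢cell : ∀ {f l x c q} → inj₁ start ≢ cell f l x c q
  start≢cell eq with () ← to-injective N-finite (inj₁-injective eq)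

  start∉row : ∀ f l c zs → inj₁ start ∉ row f l c zs
  start∉row f l c ((x , q) ∷ [])      (here eq)  = start≢cell eq
  start∉row f l c ((x , q) ∷ z ∷ zs) (here eq)  = start≢cell eq
  start∉row f l c ((x , q) ∷ z ∷ zs) (there s∈) = start∉row false l c (z ∷ zs) s∈

  start∉left : ∀ {c q f u} → LeftContext c q (f , u) → inj₁ start ∉ u
  start∉left (after _ _) (here eq) = start≢cell eq

  start∉right : ∀ {c q l v} → RightContext c q (l , v) → inj₁ start ∉ v
  start∉right (before _ _ _) (here eq) = start≢cell eq

  start∉rhs : ∀ {r} → Rule r → inj₁ start ∉ CSRule.rhs r
  start∉rhs (init c q)     (here eq) = start≢cell eq
  start∉rhs (halt _ _ _ _) (here ())
  start∉rhs (shift {q' = q'} {β = β} c p {f = f} {u = u} {l = l} e left right) s∈ with ∈-++⁻ u s∈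
  ... | inj₁ s∈u = start∉left left s∈u
  ... | inj₂ s∈' with ∈-++⁻ (row f l (not c) (recording q' β)) s∈'
  ... | inj₁ s∈γ = start∉row f l (not c) (recording q' β) s∈γ
  ... | inj₂ s∈v = start∉right right s∈v

  rules-wf : ∀ {r} → Rule r →
             (CSRule.γ r ≢ []) ⊎
             ((CSRule.left r ≡ []) × (CSRule.A r ≡ start) × (CSRule.right r ≡ []) ×
              (CSRule.γ r ≡ []) × (∀ {r'} → r' ∈ list rules → inj₁ start ∉ CSRule.rhs r'))
  rules-wf (init c q)     = inj₁ λ ()
  rules-wf (erase _)      = inj₂ (refl , refl , refl , refl , λ r∈ → start∉rhs (sound rules r∈))
  rules-wf (halt _ _ _ _) = inj₁ λ ()
  rules-wf (shift {q' = q'} c p {f = f} {l = l} e _ _) =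
    inj₁ (row≢[] f l (not c) (recording≢[] q' (expand≢[] e)))

  grammar : CSG k
  grammar = record { m = M ; S = start ; P = list rules ; wf = λ r∈ → rules-wf (sound rules r∈) }

  open CSG grammar using (_⇒_) renaming (step to ⇒-step)

  private
    infix 4 _⇒*_
    _⇒*_ = Derives grammar

  -- The colour and the column of states that a gap between two symbols carries at the levels to come.
  -- Two neighbouring cells agree on it, or the left one is one level ahead of the right one.
  Gap : Set
  Gap = Bool × List Q

  outer : Gap
  outer = true , []

  LeftGap : Bool → Bool → List Q → Gap → Set
  LeftGap true  c col b = All (_≡ q₀) col × b ≡ outer
  LeftGap false c col b = b ≡ (c , col)

  -- If the right neighbour is one level behind, the gap is described from the level of that
  -- neighbour: the colour is the opposite one, and the column begins with the recorded state `q`,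
  -- where the parent of the cell left the automaton.
  RightGap : Bool → Bool → List Q → Q → Gap → Set
  RightGap true  c col q b = All Final col × b ≡ outer
  RightGap false c col q b = b ≡ (c , col) ⊎ b ≡ (not c , q ∷ col)

  ReadN : N → Gap → Gap → List (Fin k) → Set
  ReadN (inj₁ _) b b' w = (Empty × b ≡ b' × w ≡ []) ⊎ (b ≡ outer × b' ≡ outer × Generates w)
  ReadN (inj₂ (f , l , x , c , q)) b b' w =
    ∃ λ col → ∃ λ col' → LeftGap f c col b × Grow x col col' w × RightGap l c col' q b'

  -- A meaning for single symbols relative to the gaps on both sides. A terminal demands `outer`
  -- gaps, that is, no levels to come and the colour `true`.
  Read : V → Gap → Gap → List (Fin k) → Set
  Read (inj₁ i) b b' w = ReadN (from N-finite i) b b' w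
  Read (inj₂ a) b b' w = b ≡ outer × b' ≡ outer × w ≡ [ a ]

  data Reads : List V → Gap → Gap → List (Fin k) → Set where
    []  : ∀ {b} → Reads [] b b []
    _∷_ : ∀ {s u b b' b″ w w'} → Read s b b' w → Reads u b' b″ w' → Reads (s ∷ u) b b″ (w ++ w')

  Reads-++⁺ : ∀ {u v b b' b″ w w'} → Reads u b b' w → Reads v b' b″ w' → Reads (u ++ v) b b″ (w ++ w')
  Reads-++⁺ []                       s = s
  Reads-++⁺ (_∷_ {w = w₁} {w' = w₂} r rs) s = subst (Reads _ _ _) (sym (++-assoc w₁ w₂ _)) (r ∷ Reads-++⁺ rs s)

  Reads-++⁻ : ∀ u {v b b″ w} → Reads (u ++ v) b b″ w →
              ∃ λ b' → ∃ λ w₁ → ∃ λ w₂ → w ≡ w₁ ++ w₂ × Reads u b b' w₁ × Reads v b' b″ w₂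
  Reads-++⁻ []      rs = _ , [] , _ , refl , [] , rs
  Reads-++⁻ (s ∷ u) (_∷_ {w = w₀} r rs) with Reads-++⁻ u rs
  ... | b' , w₁ , w₂ , refl , rs₁ , rs₂ = b' , w₀ ++ w₁ , w₂ , sym (++-assoc w₀ w₁ w₂) , r ∷ rs₁ , rs₂

  Reads-[-]⁻ : ∀ {s b b' w} → Reads [ s ] b b' w → Read s b b' w
  Reads-[-]⁻ {s} {b} {b'} (_∷_ {w = w} r []) = subst (Read s b b') (sym (++-identityʳ w)) r

  CellRead : Bool → Bool → X → Bool → Q → Gap → Gap → List (Fin k) → Set
  CellRead f l x c q b b' w = ReadN (inj₂ (f , l , x , c , q)) b b' w

  cell⁻ : ∀ {f l x c q b b' w} → Read (cell f l x c q) b b' w → CellRead f l x c q b b' w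
  cell⁻ {f} {l} {x} {c} {q} {b} {b'} {w} = subst (λ n → ReadN n b b' w) (from-to N-finite (inj₂ (f , l , x , c , q)))

  cell⁺ : ∀ {f l x c q b b' w} → CellRead f l x c q b b' w → Read (cell f l x c q) b b' w
  cell⁺ {f} {l} {x} {c} {q} {b} {b'} {w} = subst (λ n → ReadN n b b' w) (sym (from-to N-finite (inj₂ (f , l , x , c , q))))

  not≢ : ∀ {c} → not c ≢ c
  not≢ {c} eq = not-¬ refl (sym eq)

  -- Neighbours are level or one level apart, and the colours differ exactly in the second case; so
  -- the colours decide which alternative of `RightGap` holds.
  gap-agree : ∀ {c col col' q b} → RightGap false c col q b → LeftGap false c col' b → col ≡ col'
  gap-agree (inj₁ refl) refl = refl
  gap-agree (inj₂ refl) eq   = ⊥-elim (not≢ (cong proj₁ eq))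

  gap-ahead : ∀ {c col col' q b} → RightGap false (not c) col q b → LeftGap false c col' b → q ∷ col ≡ col'
  gap-ahead (inj₁ refl) eq = ⊥-elim (not≢ (cong proj₁ eq))
  gap-ahead (inj₂ refl) eq = cong proj₂ eq

  row-reads : ∀ f l c q β → β ≢ [] → ∀ {b b' w} → Reads (row f l c (recording q β)) b b' w →
              ∃ λ col → ∃ λ col' → LeftGap f c col b × Grows β col col' w × RightGap l c col' q b'
  row-reads f l c q [] β≢[] _ = ⊥-elim (β≢[] refl)
  row-reads f l c q (x ∷ []) _ (r ∷ []) with cell⁻ r
  ... | col , col' , left , g , right = col , col' , left , g ∷ [] , right
  row-reads f l c q (x ∷ y ∷ β) _ (r ∷ rs) with cell⁻ r | row-reads false l c q (y ∷ β) (λ ()) rs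
  ... | col , col₁ , left , g , right | col₁' , col' , left' , gs , right' with gap-agree right left'
  ... | refl = col , col' , left , g ∷ gs , right'

  start⁻ : ∀ {b b' w} → Read (inj₁ start) b b' w → ReadN (inj₁ tt) b b' w
  start⁻ {b} {b'} {w} = subst (λ n → ReadN n b b' w) (from-to N-finite (inj₁ tt))

  start⁺ : ∀ {b b' w} → ReadN (inj₁ tt) b b' w → Read (inj₁ start) b b' w
  start⁺ {b} {b'} {w} = subst (λ n → ReadN n b b' w) (sym (from-to N-finite (inj₁ tt)))

  -- Undoing the shift puts the cell back by one level, while its left neighbour stays. The
  -- neighbour, level with the children so far, is now one ahead of the cell, and its record `q`
  -- becomes the top of the column in the gap.
  left-sound : ∀ {c q f u col b b₁ w} → LeftContext c q (f , u) → Reads u b b₁ w → LeftGap f (not c) col b₁ →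
               ∃ λ b₁' → Reads u b b₁' w × LeftGap f c (q ∷ col) b₁'
  left-sound (leftmost refl) [] (starts , eq) = _ , [] , refl ∷ starts , eq
  left-sound {c} {q} {col = col} (after f y) (r ∷ []) lg with cell⁻ r
  ... | col₀ , col₁ , lg' , g , rg with gap-agree rg lg
  ... | refl = (c , q ∷ col) ,
    cell⁺ {f} {false} {y} {not c} {q}
      (col₀ , col , lg' , g , inj₂ (cong (_, q ∷ col) (sym (not-involutive c)))) ∷ [] , refl

  -- The colour of the right neighbour shows that the last child was one level ahead of it, so the
  -- gap column already begins with the recorded state. Once the cell is restored, both sides are
  -- level and the gap need not change.
  right-sound : ∀ {c q l v col p b₂ b w} → RightContext c q (l , v) → RightGap l (not c) col q b₂ → Reads v b₂ b w →
                RightGap l c (q ∷ col) p b₂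
  right-sound (rightmost fin) (finals , eq) _ = fin ∷ finals , eq
  right-sound (before l z q') rg (r ∷ []) with cell⁻ r
  ... | col' , _ , lg , _ , _ with gap-ahead rg lg
  ... | refl = inj₁ lg

  -- Undoing a rewriting step preserves readability, so a derivation of w makes the start symbol read w.
  rule-sound : ∀ {r} → Rule r → ∀ {b b' w} → Reads (CSRule.rhs r) b b' w → Reads (CSRule.lhs r) b b' w
  rule-sound (init c q) (_∷_ {w = w} r []) with cell⁻ r
  ... | col , col' , (starts , refl) , g , (finals , refl) =
    start⁺ (inj₂ (refl , refl , grows starts finals g)) ∷ []
  rule-sound (erase e) [] = start⁺ (inj₁ (e , refl , refl)) ∷ []
  rule-sound (halt f l q {x} h) ((refl , refl , refl) ∷ []) =
    cell⁺ {f} {l} {x} {true} {q} ([] , [] , left f , stop h , right l) ∷ []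
    where
    left : ∀ f → LeftGap f true [] outer
    left true  = [] , refl
    left false = refl
    right : ∀ l → RightGap l true [] q outer
    right true  = [] , refl
    right false = inj₁ refl
  rule-sound (shift {x} {q} {q'} {β} c p {f} {u} {l} {v} e left right) rs
    with Reads-++⁻ u rs
  ... | b₁ , w₁ , w' , refl , rs₁ , rs' with Reads-++⁻ (row f l (not c) (recording q' β)) rs'
  ... | b₂ , w₂ , w₃ , refl , rs₂ , rs₃ with row-reads f l (not c) q' β (expand≢[] e) rs₂
  ... | col , col' , lg , gs , rg with left-sound left rs₁ lg
  ... | b₁' , rs₁' , lg' = Reads-++⁺ rs₁'
    (cell⁺ {f} {l} {x} {c} {p} (q ∷ col , q' ∷ col' , lg' , step e gs , right-sound right rg rs₃) ∷ rs₃)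

  ⇒-sound : ∀ {u v b b' w} → u ⇒ v → Reads v b b' w → Reads u b b' w
  ⇒-sound (⇒-step {r} p q r∈) rs with Reads-++⁻ p rs
  ... | _ , _ , _ , refl , rs₁ , rs' with Reads-++⁻ (CSRule.rhs r) rs'
  ... | _ , _ , _ , refl , rs₂ , rs₃ = Reads-++⁺ rs₁ (Reads-++⁺ (rule-sound (sound rules r∈) rs₂) rs₃)

  ⇒*-sound : ∀ {u v b b' w} → u ⇒* v → Reads v b b' w → Reads u b b' w
  ⇒*-sound ε        rs = rs
  ⇒*-sound (s ◅ d) rs = ⇒-sound s (⇒*-sound d rs)

  terminals-read : ∀ w → Reads (map inj₂ w) outer outer w
  terminals-read []      = []
  terminals-read (a ∷ w) = (refl , refl , refl) ∷ terminals-read w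

  grammar-sound : ∀ w → CSG.lang grammar w → Generates w
  grammar-sound w d with start⁻ (Reads-[-]⁻ (⇒*-sound d (terminals-read w)))
  ... | inj₁ (e , _ , refl) = empty e
  ... | inj₂ (_ , _ , g)    = g

  -- Completeness: one sweep per level

  row-++ : ∀ f l c z zs z' zs' → row f l c (z ∷ zs ++ z' ∷ zs') ≡ row f false c (z ∷ zs) ++ row false l c (z' ∷ zs')
  row-++ f l c z []        z' zs' = refl
  row-++ f l c z (z₁ ∷ zs) z' zs' = cong (_ ∷_) (row-++ false l c z₁ zs z' zs')

  row-last : ∀ f c q x β → ∃ λ p → ∃ λ f' → ∃ λ y → row f false c (recording q (x ∷ β)) ≡ p ++ [ cell f' false y c q ]
  row-last f c q x []      = [] , f , x , refl
  row-last f c q x (y ∷ β) with row-last false c q y β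
  ... | p , f' , y' , eq = cell f false x c q ∷ p , f' , y' , cong (_ ∷_) eq

  row-first : ∀ l c x q zs → ∃ λ l' → ∃ λ rest → row false l c ((x , q) ∷ zs) ≡ cell false l' x c q ∷ rest
  row-first l c x q []       = l , [] , refl
  row-first l c x q (_ ∷ _) = false , _ , refl

  contents : List (X × Q) → List X
  contents = map proj₁

  contents-recording : ∀ q β → contents (recording q β) ≡ β
  contents-recording q β = trans (sym (map-∘ β)) (map-id β)

  Grows-++⁺ : ∀ {xs ys c c' c″ u v} → Grows xs c c' u → Grows ys c' c″ v → Grows (xs ++ ys) c c″ (u ++ v)
  Grows-++⁺ []                         hs = hs
  Grows-++⁺ (_∷_ {u = u} {v = v} g gs) hs = subst (Grows _ _ _) (sym (++-assoc u v _)) (g ∷ Grows-++⁺ gs hs)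

  ⇒*-rewrite : ∀ {u a v γ} p q → Rule (csrule u a v γ) → p ++ (u ++ inj₁ a ∷ v) ++ q ⇒* p ++ (u ++ γ ++ v) ++ q
  ⇒*-rewrite p q r = ⇒-step p q (complete rules r) ◅ ε

  record Swept (f c : Bool) (u : List V) (zs : List (X × Q)) (col col' : List Q) (w : List (Fin k)) : Set where
    constructor swept
    field
      head  : X × Q
      tail  : List (X × Q)
      below : Grows (contents (head ∷ tail)) col col' w
      derivation : u ++ row f true c zs ⇒* u ++ row f true (not c) (head ∷ tail)

  -- Induction from left to right. Once the first cell is rewritten, the last of its children has
  -- the colour `not c` and the right record, so it serves as the context `u` for the remaining
  -- cells.
  sweep : ∀ {c q q' f u col col' w} z zs → LeftContext c q (f , u) → Final q' →
          Grows (contents (z ∷ zs)) (q ∷ col) (q' ∷ col') w → Swept f c u (z ∷ zs) col col' w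
  sweep _ [] _ _ (step {β = []} e _ ∷ _) = ⊥-elim (expand≢[] e refl)
  sweep {c} {f = f} {u} {col} {col'} (x , p) [] left fin (step {q' = q'} {β = y ∷ β} e gs ∷ []) = swept (y , q') (recording q' β)
    (subst₂ (λ xs → Grows xs col col') (sym (contents-recording q' (y ∷ β))) (sym (++-identityʳ _)) gs)
    (subst₂ _⇒*_ (++-identityʳ _) (trans (++-identityʳ _) (cong (u ++_) (++-identityʳ _)))
      (⇒*-rewrite [] [] (shift c p e left (rightmost fin))))
  sweep _ (_ ∷ _) _ _ (step {β = []} e _ ∷ _) = ⊥-elim (expand≢[] e refl)
  sweep {c} {f = f} {u} {col} {col'} (x , p) ((x' , p') ∷ zs) left fin
        (_∷_ {u = w₁} {v = w₂} (step {q' = q₁} {β = y ∷ β} e gs) hs)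
    with row-last f (not c) q₁ y β
  ... | r , f' , y' , eq with sweep {c} (x' , p') zs (after f' y') fin hs
  ... | swept (h , t) tl below d = swept (y , q₁) (recording q₁ β ++ (h , t) ∷ tl)
    (subst (λ xs → Grows xs col col' (w₁ ++ w₂))
      (sym (trans (map-++ proj₁ (recording q₁ (y ∷ β)) ((h , t) ∷ tl)) (cong (_++ contents ((h , t) ∷ tl)) (contents-recording q₁ (y ∷ β)))))
      (Grows-++⁺ gs below))
    (first ◅◅ rest)
    where
    next = row false true c ((x' , p') ∷ zs)
    first : u ++ cell f false x c p ∷ next ⇒* u ++ row f false (not c) (recording q₁ (y ∷ β)) ++ next
    first with row-first true c x' p' zs
    ... | l' , tail , eq' rewrite eq' = subst₂ _⇒*_ (++-assoc u _ tail)
      (trans (++-assoc u _ tail) (cong (u ++_) (++-assoc (row f false (not c) (recording q₁ (y ∷ β))) _ tail)))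
      (⇒*-rewrite [] tail (shift c p e left (before l' x' p')))
    split : ∀ s → u ++ row f false (not c) (recording q₁ (y ∷ β)) ++ s ≡
                  (u ++ r) ++ (cell f' false y' (not c) q₁ ∷ s) ++ []
    split s = begin
      u ++ row f false (not c) (recording q₁ (y ∷ β)) ++ s        ≡⟨ cong (λ v → u ++ v ++ s) eq ⟩
      u ++ (r ++ [ cell f' false y' (not c) q₁ ]) ++ s            ≡⟨ cong (u ++_) (++-assoc r _ s) ⟩
      u ++ r ++ cell f' false y' (not c) q₁ ∷ s                   ≡⟨ ++-assoc u r _ ⟨
      (u ++ r) ++ cell f' false y' (not c) q₁ ∷ s                 ≡⟨ cong ((u ++ r) ++_) (++-identityʳ _) ⟨
      (u ++ r) ++ (cell f' false y' (not c) q₁ ∷ s) ++ []         ∎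
      where open ≡-Reasoning
    rest : u ++ row f false (not c) (recording q₁ (y ∷ β)) ++ next ⇒*
           u ++ row f true (not c) (recording q₁ (y ∷ β) ++ (h , t) ∷ tl)
    rest = subst₂ _⇒*_ (sym (split next))
      (sym (trans (cong (u ++_) (row-++ f true (not c) (y , q₁) (recording q₁ β) (h , t) tl)) (split _)))
      (⇒*-cong grammar (u ++ r) [] d)

  -- Colours are counted from the last level, which must be `true` for `halt`; the root therefore
  -- has to guess `parity c` for its column `c`.
  parity : List Q → Bool
  parity []        = true
  parity (_ ∷ col) = not (parity col)

  halt-row : ∀ f zs {w} → Grows (contents zs) [] [] w → row f true true zs ⇒* map inj₂ w
  halt-row f []                 []                 = ε
  halt-row f ((x , q) ∷ [])     (stop h ∷ [])      = ⇒*-rewrite [] [] (halt f true q h)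
  halt-row f ((x , q) ∷ z ∷ zs) (stop {a = a} h ∷ gs) = ⇒*-rewrite [] _ (halt f false q h) ◅◅
    subst₂ _⇒*_ (cong (inj₂ a ∷_) (++-identityʳ _)) (cong (inj₂ a ∷_) (++-identityʳ _))
      (⇒*-cong grammar [ inj₂ a ] [] (halt-row false (z ∷ zs) gs))

  Grow-[] : ∀ {x c' w} → Grow x [] c' w → c' ≡ []
  Grow-[] (stop _) = refl

  Grows-[] : ∀ {xs c' w} → Grows xs [] c' w → c' ≡ []
  Grows-[] []       = refl
  Grows-[] (g ∷ gs) with Grow-[] g
  ... | refl = Grows-[] gs

  Grows-∷ : ∀ {xs q c c' w} → Grows xs (q ∷ c) c' w → ∃ λ q' → ∃ λ c″ → c' ≡ q' ∷ c″
  Grows-∷ []              = _ , _ , refl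
  Grows-∷ (step _ _ ∷ gs) = Grows-∷ gs

  row-complete : ∀ {col col' w} z zs → All (_≡ q₀) col → All Final col' → Grows (contents (z ∷ zs)) col col' w →
                 row true true (parity col) (z ∷ zs) ⇒* map inj₂ w
  row-complete {[]}      z zs _ _ gs with Grows-[] gs
  ... | refl = halt-row true (z ∷ zs) gs
  row-complete {q ∷ col} z zs (refl ∷ starts) finals gs with Grows-∷ gs | finals
  ... | q' , c' , refl | fin ∷ finals' with sweep {c = not (parity col)} z zs (leftmost refl) fin gs
  ... | swept z' zs' below d = d ◅◅
    subst (λ c → row true true c (z' ∷ zs') ⇒* _) (sym (not-involutive (parity col)))
      (row-complete z' zs' starts finals' below)

  grammar-complete : ∀ w → Generates w → CSG.lang grammar w
  grammar-complete _ (empty e) = ⇒*-rewrite [] [] (erase e)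
  grammar-complete w (grows {c} starts finals g) = ⇒*-rewrite [] [] (init (parity c) q₀) ◅◅
    row-complete (x₀ , q₀) [] starts finals (subst (Grows _ _ _) (++-identityʳ w) (g ∷ []))

-- From tree control to level-by-level growth

module Automaton {A : Set} (_≟_ : DecidableEquality A) where

  -- A state of `e · f` lies in one of the two factors; the state `inj₁ tt` of `e *` means that no
  -- iteration has begun.
  State : UFExp A → Set
  State ∅       = ⊤
  State (lit a) = Bool
  State (e · f) = State e ⊎ State f
  State (e *)   = ⊤ ⊎ State e

  initial : ∀ e → State e
  initial ∅       = tt
  initial (lit a) = false
  initial (e · f) = inj₁ (initial e)
  initial (e *)   = inj₁ tt

  -- What remains to be read in a state, in the manner of Antimirov's partial derivatives.
  -- Correctness of the automaton means that `δ` and `Final` match the letters and the empty word of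
  -- this expression.
  residual : ∀ e → State e → UFExp A
  residual ∅       _        = ∅
  residual (lit a) false    = lit a
  residual (lit a) true     = ∅ *
  residual (e · f) (inj₁ s) = residual e s · f
  residual (e · f) (inj₂ t) = residual f t
  residual (e *)   (inj₁ _) = e *
  residual (e *)   (inj₂ s) = residual e s · (e *)

  Final : ∀ e → State e → Set
  Final ∅       _        = ⊥
  Final (lit a) false    = ⊥
  Final (lit a) true     = ⊤
  Final (e · f) (inj₁ s) = Final e s × Final f (initial f)
  Final (e · f) (inj₂ t) = Final f t
  Final (e *)   (inj₁ _) = ⊤
  Final (e *)   (inj₂ s) = Final e s

  -- Passing to the next factor or iteration is merged with reading its first letter. There are no
  -- silent moves, so each symbol of a level makes exactly one transition.
  δ : ∀ e → State e → A → State e → Set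
  δ ∅       _        _ _         = ⊥
  δ (lit a) false    b true      = a ≡ b
  δ (lit a) _        b _         = ⊥
  δ (e · f) (inj₁ s) b (inj₁ s') = δ e s b s'
  δ (e · f) (inj₁ s) b (inj₂ t') = Final e s × δ f (initial f) b t'
  δ (e · f) (inj₂ t) b (inj₁ s') = ⊥
  δ (e · f) (inj₂ t) b (inj₂ t') = δ f t b t'
  δ (e *)   _        b (inj₁ _)  = ⊥
  δ (e *)   (inj₁ _) b (inj₂ s') = δ e (initial e) b s'
  δ (e *)   (inj₂ s) b (inj₂ s') = δ e s b s' ⊎ (Final e s × δ e (initial e) b s')

  State-finite : ∀ e → Finite (State e)
  State-finite ∅       = ⊤-finite
  State-finite (lit a) = Bool-finite
  State-finite (e · f) = State-finite e ⊎-finite State-finite f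
  State-finite (e *)   = ⊤-finite ⊎-finite State-finite e

  Final? : ∀ e s → Dec (Final e s)
  Final? ∅       _        = no λ ()
  Final? (lit a) false    = no λ ()
  Final? (lit a) true     = yes tt
  Final? (e · f) (inj₁ s) = Final? e s ×-dec Final? f (initial f)
  Final? (e · f) (inj₂ t) = Final? f t
  Final? (e *)   (inj₁ _) = yes tt
  Final? (e *)   (inj₂ s) = Final? e s

  δ? : ∀ e s b s' → Dec (δ e s b s')
  δ? ∅       _        _ _         = no λ ()
  δ? (lit a) false    b true      = a ≟ b
  δ? (lit a) false    b false     = no λ ()
  δ? (lit a) true     b _         = no λ ()
  δ? (e · f) (inj₁ s) b (inj₁ s') = δ? e s b s'
  δ? (e · f) (inj₁ s) b (inj₂ t') = Final? e s ×-dec δ? f (initial f) b t'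
  δ? (e · f) (inj₂ t) b (inj₁ s') = no λ ()
  δ? (e · f) (inj₂ t) b (inj₂ t') = δ? f t b t'
  δ? (e *)   (inj₁ _) b (inj₁ _)  = no λ ()
  δ? (e *)   (inj₂ _) b (inj₁ _)  = no λ ()
  δ? (e *)   (inj₁ _) b (inj₂ s') = δ? e (initial e) b s'
  δ? (e *)   (inj₂ s) b (inj₂ s') = δ? e s b s' ⊎-dec (Final? e s ×-dec δ? e (initial e) b s')

  residual-initial : ∀ e → residual e (initial e) ≡ e
  residual-initial ∅       = refl
  residual-initial (lit a) = refl
  residual-initial (e · f) = cong (_· f) (residual-initial e)
  residual-initial (e *)   = refl

  cat⁻ : ∀ {e f : UFExp A} {w} → ⟦ e · f ⟧ w → ∃ λ u → ∃ λ v → u ++ v ≡ w × ⟦ e ⟧ u × ⟦ f ⟧ v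
  cat⁻ (cat p q) = _ , _ , refl , p , q

  final-sound : ∀ e s → Final e s → ⟦ residual e s ⟧ []
  final-sound (lit a) true     _       = nil
  final-sound (e · f) (inj₁ s) (p , q) =
    cat (final-sound e s p) (subst (λ g → ⟦ g ⟧ []) (residual-initial f) (final-sound f (initial f) q))
  final-sound (e · f) (inj₂ t) p       = final-sound f t p
  final-sound (e *)   (inj₁ _) _       = nil
  final-sound (e *)   (inj₂ s) p       = cat (final-sound e s p) nil

  final-complete : ∀ e s → ⟦ residual e s ⟧ [] → Final e s
  final-complete (lit a) true     _ = tt
  final-complete (e · f) (inj₁ s) p with cat⁻ p
  ... | [] , [] , _ , p₁ , p₂ =
    final-complete e s p₁ , final-complete f (initial f) (subst (λ g → ⟦ g ⟧ []) (sym (residual-initial f)) p₂)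
  final-complete (e · f) (inj₂ t) p = final-complete f t p
  final-complete (e *)   (inj₁ _) _ = tt
  final-complete (e *)   (inj₂ s) p with cat⁻ p
  ... | [] , [] , _ , p₁ , _ = final-complete e s p₁

  δ-sound : ∀ e s {b s' w} → δ e s b s' → ⟦ residual e s' ⟧ w → ⟦ residual e s ⟧ (b ∷ w)
  δ-sound (lit a) false {s' = true} refl nil         = lit
  δ-sound (lit a) false {s' = true} refl (more () _)
  δ-sound (e · f) (inj₁ s) {s' = inj₁ s'} d p with cat⁻ p
  ... | _ , _ , refl , p₁ , p₂ = cat (δ-sound e s d p₁) p₂
  δ-sound (e · f) (inj₁ s) {s' = inj₂ t'} (fin , d) p =
    cat (final-sound e s fin) (subst (λ g → ⟦ g ⟧ _) (residual-initial f) (δ-sound f (initial f) d p))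
  δ-sound (e · f) (inj₂ t) {s' = inj₂ t'} d p = δ-sound f t d p
  δ-sound (e *) (inj₁ _) {s' = inj₂ s'} d p with cat⁻ p
  ... | _ , _ , refl , p₁ , p₂ = more (subst (λ g → ⟦ g ⟧ _) (residual-initial e) (δ-sound e (initial e) d p₁)) p₂
  δ-sound (e *) (inj₂ s) {s' = inj₂ s'} (inj₁ d) p with cat⁻ p
  ... | _ , _ , refl , p₁ , p₂ = cat (δ-sound e s d p₁) p₂
  δ-sound (e *) (inj₂ s) {s' = inj₂ s'} (inj₂ (fin , d)) p with cat⁻ p
  ... | _ , _ , refl , p₁ , p₂ =
    cat (final-sound e s fin) (more (subst (λ g → ⟦ g ⟧ _) (residual-initial e) (δ-sound e (initial e) d p₁)) p₂)

  star-∷⁻ : ∀ {e : UFExp A} {b w} → ⟦ e * ⟧ (b ∷ w) → ∃ λ u → ∃ λ v → u ++ v ≡ w × ⟦ e ⟧ (b ∷ u) × ⟦ e * ⟧ v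
  star-∷⁻ p = go p refl
    where
    go : ∀ {e : UFExp A} {b w w'} → ⟦ e * ⟧ w' → w' ≡ b ∷ w →
         ∃ λ u → ∃ λ v → u ++ v ≡ w × ⟦ e ⟧ (b ∷ u) × ⟦ e * ⟧ v
    go (more {u = []}    _ q) eq   = go q eq
    go (more {u = _ ∷ u} p q) refl = u , _ , refl , p , q

  δ-complete : ∀ e s {b w} → ⟦ residual e s ⟧ (b ∷ w) → ∃ λ s' → δ e s b s' × ⟦ residual e s' ⟧ w
  δ-complete (lit a) false lit = true , refl , nil
  δ-complete (lit a) true  p with star-∷⁻ p
  ... | _ , _ , _ , () , _
  δ-complete (e · f) (inj₁ s) p with cat⁻ p
  ... | [] , _ , refl , p₁ , p₂ =
    let t' , d , q = δ-complete f (initial f) (subst (λ g → ⟦ g ⟧ _) (sym (residual-initial f)) p₂)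
    in inj₂ t' , (final-complete e s p₁ , d) , q
  ... | _ ∷ _ , _ , refl , p₁ , p₂ =
    let s' , d , q = δ-complete e s p₁ in inj₁ s' , d , cat q p₂
  δ-complete (e · f) (inj₂ t) p = let t' , d , q = δ-complete f t p in inj₂ t' , d , q
  δ-complete (e *) (inj₁ _) p with star-∷⁻ p
  ... | _ , _ , refl , p₁ , p₂ =
    let s' , d , q = δ-complete e (initial e) (subst (λ g → ⟦ g ⟧ _) (sym (residual-initial e)) p₁)
    in inj₂ s' , d , cat q p₂
  δ-complete (e *) (inj₂ s) p with cat⁻ p
  ... | _ ∷ _ , _ , refl , p₁ , p₂ = let s' , d , q = δ-complete e s p₁ in inj₂ s' , inj₁ d , cat q p₂
  ... | [] , _ , refl , p₁ , p₂ with star-∷⁻ p₂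
  ... | _ , _ , refl , p₃ , p₄ =
    let s' , d , q = δ-complete e (initial e) (subst (λ g → ⟦ g ⟧ _) (sym (residual-initial e)) p₃)
    in inj₂ s' , inj₂ (final-complete e s p₁ , d) , cat q p₄

  data Run (e : UFExp A) : State e → List A → State e → Set where
    []  : ∀ {s} → Run e s [] s
    _∷_ : ∀ {s s' s″ b w} → δ e s b s' → Run e s' w s″ → Run e s (b ∷ w) s″

  Run-++⁺ : ∀ {e s s' s″ u v} → Run e s u s' → Run e s' v s″ → Run e s (u ++ v) s″
  Run-++⁺ []      r' = r'
  Run-++⁺ (d ∷ r) r' = d ∷ Run-++⁺ r r'

  Run-++⁻ : ∀ {e s s″} u {v} → Run e s (u ++ v) s″ → ∃ λ s' → Run e s u s' × Run e s' v s″
  Run-++⁻ []      r       = _ , [] , r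
  Run-++⁻ (_ ∷ u) (d ∷ r) = let s' , r₁ , r₂ = Run-++⁻ u r in s' , d ∷ r₁ , r₂

  Run-sound : ∀ {e s s' w} → Run e s w s' → Final e s' → ⟦ residual e s ⟧ w
  Run-sound {e} {s} []      fin = final-sound e s fin
  Run-sound {e} {s} (d ∷ r) fin = δ-sound e s d (Run-sound r fin)

  Run-complete : ∀ {e} s w → ⟦ residual e s ⟧ w → ∃ λ s' → Run e s w s' × Final e s'
  Run-complete {e} s []      p = s , [] , final-complete e s p
  Run-complete {e} s (b ∷ w) p with δ-complete e s p
  ... | s' , d , q with Run-complete s' w q
  ... | s″ , r , fin = s″ , d ∷ r , fin

module FromTC {k} (G : TCG k) where
  open TCG G hiding (lang)

  V : Set
  V = Sym m k

  V-finite : Finite V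
  V-finite = Fin-finite m ⊎-finite Fin-finite k

  open Automaton (Finite._≟_ V-finite)

  Q : Set
  Q = State R

  Q-finite : Finite Q
  Q-finite = State-finite R

  -- A terminal is live at its own level and dead at the lower ones, where it is invisible to the control.
  pattern live x = inj₁ x
  pattern dead a = inj₂ a

  liveˣ : V → V ⊎ Fin k
  liveˣ x = live x

  X : Set
  X = V ⊎ Fin k

  data Expand : X × Q × Q × List X → Set where
    rewrites : ∀ {A α q q'} → α ≢ [] → (A , α) ∈ P → δ R q (inj₁ A) q' → Expand (live (inj₁ A) , q , q' , map liveˣ α)
    dies     : ∀ {a q q'} → δ R q (inj₂ a) q' → Expand (live (inj₂ a) , q , q' , [ dead a ])
    rests    : ∀ a q → Expand (dead a , q , q , [ dead a ])

  data Halt : X × Fin k → Set where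
    live-halt : ∀ a → Halt (live (inj₂ a) , a)
    dead-halt : ∀ a → Halt (dead a , a)

  private
    terminals = every (Fin-finite k)
    states    = every Q-finite

  -- The sole tree with root `S` and a λ-leaf is `nodeλ S`; its level 0 still has to pass the
  -- control.
  Empty : Set
  Empty = (S , []) ∈ P × ∃ λ q → δ R (initial R) (inj₁ S) q × Final R q

  rule? : DecidableEquality (Fin m × List V)
  rule? = Product.≡-dec (Finite._≟_ (Fin-finite m)) (≡-dec (Finite._≟_ V-finite))

  system : Levelled k
  system = record
    { X = X ; Q = Q ; X-finite = V-finite ⊎-finite Fin-finite k ; Q-finite = Q-finite
    ; Expand = Expand ; Halt = Halt
    ; expands = reindex
        (λ { (inj₁ (_ , A∈ , q , _ , q' , _ , ne , d , refl)) → rewrites ne A∈ d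
           ; (inj₂ (inj₁ (a , _ , q , _ , q' , _ , d , refl))) → dies d
           ; (inj₂ (inj₂ (a , _ , q , _ , refl))) → rests a q })
        (λ { (rewrites ne A∈ d) → inj₁ (_ , A∈ , _ , tt , _ , tt , ne , d , refl)
           ; (dies d) → inj₂ (inj₁ (_ , tt , _ , tt , _ , tt , d , refl))
           ; (rests a q) → inj₂ (inj₂ (a , tt , q , tt , refl)) })
        ((members P ≫= λ (A , α) → states ≫= λ q → states ≫= λ q' →
            guard (¬? (null? α)) (guard (δ? R q (inj₁ A) q') ⟨ _ ⟩)) ∪
         ((terminals ≫= λ a → states ≫= λ q → states ≫= λ q' → guard (δ? R q (inj₂ a) q') ⟨ _ ⟩) ∪
          (terminals ≫= λ a → states ≫= λ q → ⟨ _ ⟩)))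
    ; expand≢[] = λ { (rewrites {α = []} ne _ _) → λ _ → ne refl ; (rewrites {α = _ ∷ _} _ _ _) → λ ()
                    ; (dies _) → λ () ; (rests _ _) → λ () }
    ; halts = reindex
        (λ { (inj₁ (a , _ , refl)) → live-halt a ; (inj₂ (a , _ , refl)) → dead-halt a })
        (λ { (live-halt a) → inj₁ (a , tt , refl) ; (dead-halt a) → inj₂ (a , tt , refl) })
        ((terminals ≫= λ a → ⟨ _ ⟩) ∪ (terminals ≫= λ a → ⟨ _ ⟩))
    ; x₀ = live (inj₁ S) ; q₀ = initial R
    ; Final = Final R ; Final? = Final? R
    ; Empty = Empty
    ; Empty? = any? (rule? (S , [])) P ×-dec
               Finite.∃? Q-finite (λ q → δ? R (initial R) (inj₁ S) q ×-dec Final? R q)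
    }

  open Levelled system using (Grow; Grows; stop; step; []; _∷_; Generates; empty; grows)

  -- Columns of runs and their trees

  -- Words `f j` with `j` beyond the columns are unconstrained. Columns as long as the height of a
  -- tree thus leave its last level free.
  data Columns : List Q → (ℕ → List V) → List Q → Set where
    []  : ∀ {f} → Columns [] f []
    _∷_ : ∀ {q q' c c' f} → Run R q (f 0) q' → Columns c (f ∘ suc) c' → Columns (q ∷ c) f (q' ∷ c')

  Columns-++⁺ : ∀ {f g c c' c″} → Columns c f c' → Columns c' g c″ → Columns c (λ j → f j ++ g j) c″
  Columns-++⁺ []       []         = []
  Columns-++⁺ (r ∷ rs) (r' ∷ rs') = Run-++⁺ r r' ∷ Columns-++⁺ rs rs'

  Columns-++⁻ : ∀ {f g c c″} → Columns c (λ j → f j ++ g j) c″ → ∃ λ c' → Columns c f c' × Columns c' g c″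
  Columns-++⁻ []               = [] , [] , []
  Columns-++⁻ {f} (r ∷ rs) with Run-++⁻ (f 0) r | Columns-++⁻ rs
  ... | q , r₁ , r₂ | c' , rs₁ , rs₂ = q ∷ c' , r₁ ∷ rs₁ , r₂ ∷ rs₂

  blank⁺ : ∀ c → Columns c (λ _ → []) c
  blank⁺ []      = []
  blank⁺ (q ∷ c) = [] ∷ blank⁺ c

  blank⁻ : ∀ {c c'} → Columns c (λ _ → []) c' → c ≡ c'
  blank⁻ []        = refl
  blank⁻ ([] ∷ rs) = cong (_ ∷_) (blank⁻ rs)

  Columns-length : ∀ {c f c'} → Columns c f c' → length c ≡ length c'
  Columns-length []       = refl
  Columns-length (_ ∷ rs) = cong suc (Columns-length rs)

  columns : ∀ h f → (∀ j → j < h → ⟦ R ⟧ (f j)) →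
            ∃ λ c → ∃ λ c' → Columns c f c' × All (_≡ initial R) c × All (Final R) c' × length c ≡ h
  columns zero    f _  = [] , [] , [] , [] , [] , refl
  columns (suc h) f f∈
    with Run-complete (initial R) (f 0) (subst (λ e → ⟦ e ⟧ (f 0)) (sym (residual-initial R)) (f∈ 0 (s≤s z≤n)))
       | columns h (f ∘ suc) (λ j j<h → f∈ (suc j) (s≤s j<h))
  ... | q' , r , fin | c , c' , rs , starts , finals , len =
    initial R ∷ c , q' ∷ c' , r ∷ rs , refl ∷ starts , fin ∷ finals , cong suc len

  columns-accepted : ∀ {c f c'} → Columns c f c' → All (_≡ initial R) c → All (Final R) c' →
                     ∀ j → j < length c → ⟦ R ⟧ (f j)
  columns-accepted {f = f} (r ∷ rs) (refl ∷ _) (fin ∷ _) zero _ =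
    subst (λ e → ⟦ e ⟧ (f 0)) (residual-initial R) (Run-sound r fin)
  columns-accepted (_ ∷ rs) (_ ∷ starts) (_ ∷ finals) (suc j) (s≤s j<) = columns-accepted rs starts finals j j<

  dead-grow : ∀ a c → Grow (dead a) c c [ a ]
  dead-grow a []      = stop (dead-halt a)
  dead-grow a (q ∷ c) = step (rests a q) (dead-grow a c ∷ [])

  dead-grow⁻ : ∀ {a c c' w} → Grow (dead a) c c' w → c ≡ c' × w ≡ [ a ]
  dead-grow⁻ (stop (dead-halt a))       = refl , refl
  dead-grow⁻ (step (rests a q) (g ∷ [])) with dead-grow⁻ g
  ... | refl , refl = refl , refl

  Proper : Tree {m} {k} → Set
  Proper (nodeλ _) = ⊥
  Proper _         = ⊤

  Produced : V → Set
  Produced x = ∃ λ B → ∃ λ β → (B , β) ∈ P × x ∈ β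

  -- Only `S` can be erased, and then it stands on no right-hand side; so `nodeλ` never occurs below
  -- the root.
  proper : ∀ t → Valid P t → Produced (label t) → Proper t
  proper (leaf _)   _  _ = tt
  proper (node _ _) _  _ = tt
  proper (nodeλ A)  r∈ (B , β , B∈ , A∈) with wf r∈
  ... | inj₁ ne                = ne refl
  ... | inj₂ (refl , _ , S∉) = S∉ B∈ A∈

  mutual
    tree-grow : ∀ t {c c'} → height t ≤ length c → Valid P t → Proper t →
                Columns c (λ j → level j t) c' → Grow (live (label t)) c c' (yield t)
    tree-grow (leaf a) _ _ _ []              = stop (live-halt a)
    -- A leaf above the bottom is read by the control once and then carried down as `dead`.
    tree-grow (leaf a) _ _ _ ((d ∷ []) ∷ rs) with blank⁻ rs
    ... | refl = step (dies d) (dead-grow a _ ∷ [])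
    tree-grow (node A [])       _        (ne , _ , _)  _ _               = ⊥-elim (ne refl)
    tree-grow (node A ts@(_ ∷ _)) (s≤s h≤) (_ , A∈ , v) _ ((d ∷ []) ∷ rs) =
      step (rewrites (λ ()) A∈ d) (forest-grow ts h≤ v (λ x∈ → A , _ , A∈ , x∈) rs)

    forest-grow : ∀ ts {c c'} → heights ts ≤ length c → AllValid P ts →
                  (∀ {x} → x ∈ map label ts → Produced x) →
                  Columns c (λ j → levels j ts) c' → Grows (map liveˣ (map label ts)) c c' (yields ts)
    forest-grow []       _ _ _ rs with blank⁻ rs
    ... | refl = []
    forest-grow (t ∷ ts) {c} h≤ (v , vs) prod rs with Columns-++⁻ {λ j → level j t} rs
    ... | c' , rs₁ , rs₂ =
      tree-grow t (m⊔n≤o⇒m≤o (height t) (heights ts) h≤) v (proper t v (prod (here refl))) rs₁ ∷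
      forest-grow ts (subst (heights ts ≤_) (Columns-length rs₁) (m⊔n≤o⇒n≤o (height t) (heights ts) h≤))
        vs (prod ∘ there) rs₂

  system-complete : ∀ w → TCG.lang G w → Generates w
  system-complete w (nodeλ A , refl , r∈ , refl , lv) with Run-complete (initial R) [ inj₁ S ]
    (subst (λ e → ⟦ e ⟧ [ inj₁ S ]) (sym (residual-initial R)) (lv 0 (s≤s z≤n)))
  ... | q , d ∷ [] , fin = empty (r∈ , q , d , fin)
  system-complete w (t@(node A ts) , refl , v , refl , lv) with columns (height t) (λ j → level j t) lv
  ... | c , c' , rs , starts , finals , len =
    grows starts finals (tree-grow t (≤-reflexive (sym len)) v tt rs)

  record GrownTree (x : V) (c c' : List Q) (w : List (Fin k)) : Set where
    constructor grown-tree
    field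
      tree    : Tree {m} {k}
      label≡  : label tree ≡ x
      valid   : Valid P tree
      yield≡  : yield tree ≡ w
      height≤ : height tree ≤ length c
      runs    : Columns c (λ j → level j tree) c'

  record GrownForest (α : List V) (c c' : List Q) (w : List (Fin k)) : Set where
    constructor grown-forest
    field
      trees    : List (Tree {m} {k})
      labels≡  : map label trees ≡ α
      valid    : AllValid P trees
      yields≡  : yields trees ≡ w
      heights≤ : heights trees ≤ length c
      runs     : Columns c (λ j → levels j trees) c'

  mutual
    tree-of : ∀ {x c c' w} → Grow (live x) c c' w → GrownTree x c c' w
    tree-of (stop (live-halt a)) = grown-tree (leaf a) refl tt refl z≤n []
    tree-of (step {c = c} (dies {a} d) (g ∷ [])) with dead-grow⁻ g
    ... | refl , refl = grown-tree (leaf a) refl tt refl z≤n ((d ∷ []) ∷ blank⁺ c)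
    tree-of (step (rewrites {A} {α} ne A∈ d) gs) with forest-of α gs
    ... | grown-forest ts refl v refl h≤ rs =
      grown-tree (node A ts) refl ((λ { refl → ne refl }) , A∈ , v) refl (s≤s h≤) ((d ∷ []) ∷ rs)

    forest-of : ∀ α {c c' w} → Grows (map liveˣ α) c c' w → GrownForest α c c' w
    forest-of []      {c} []       = grown-forest [] refl tt refl z≤n (blank⁺ c)
    forest-of (x ∷ α) {c} (g ∷ gs) with tree-of g | forest-of α gs
    ... | grown-tree t refl v refl h≤ rs | grown-forest ts refl vs refl hs≤ rs' =
      grown-forest (t ∷ ts) refl (v , vs) refl
        (⊔-lub h≤ (subst (heights ts ≤_) (sym (Columns-length rs)) hs≤)) (Columns-++⁺ rs rs')

  system-sound : ∀ w → Generates w → TCG.lang G w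
  system-sound _ (empty (S∈ , q , d , fin)) = nodeλ S , refl , S∈ , refl , λ where
    zero    _        → subst (λ e → ⟦ e ⟧ [ inj₁ S ]) (residual-initial R) (Run-sound {R} {initial R} {q} (d ∷ []) fin)
    (suc _) (s≤s ())
  system-sound w (grows starts finals g) with tree-of g
  ... | grown-tree t label≡ v yield≡ h≤ rs =
    t , label≡ , v , yield≡ , λ j j<h → columns-accepted rs starts finals j (<-≤-trans j<h h≤)

theorem24 : ∀ (k : ℕ) (L : Language k) → (InTCUF L → InCS L) × (InCS L → InTCUF L)
theorem24 k L = to-CS , to-TC
  where
  to-CS : InTCUF L → InCS L
  to-CS (G , L⊆G , G⊆L) = FromLevelled.grammar system ,
    (λ w → FromLevelled.grammar-complete system w ∘ system-complete w ∘ L⊆G w) ,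
    (λ w → G⊆L w ∘ system-sound w ∘ FromLevelled.grammar-sound system w)
    where open FromTC G
  to-TC : InCS L → InTCUF L
  to-TC (G , L⊆G , G⊆L) = grammar , (λ w → grammar-complete w ∘ L⊆G w) , (λ w → G⊆L w ∘ grammar-sound w)
    where open FromCS G
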